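{- (1) For any graph $G$ with $\chi(G)\geq 4$, one has $\chi_2(G)\leq \chi(G)+\alpha(G)$. (2) If $G$ is a $k$-regular graph with $\chi(G)\geq 4$, then $\chi_2(G)\leq \chi(G)+\alpha(G^2)$.
   Context: Graphs are finite and simple. $\chi(G)$ denotes the chromatic number of $G$ and $\alpha(G)$ its independence number (maximum size of an independent set). A dynamic $l$-coloring of $G$ is a proper vertex coloring of $G$ with colors in $\{1,\ldots,l\}$ such that for every vertex $v$ of degree at least $2$, at least two different colors appear on the neighbors of $v$. The dynamic chromatic number $\chi_2(G)$ is the smallest integer $l$ such that $G$ has a dynamic $l$-coloring. The graph $G^2$ has vertex set $V(G)$, and two different vertices $u,v$ are adjacent in $G^2$ if and only if $d_G(u,v)\leq 2$, where $d_G$ is the distance in $G$. -}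

module Defs where

open import Data.Nat using (ℕ; zero; suc; _≤_; z≤n; s≤s; s≤s⁻¹)
import Data.Nat.Properties as ℕ
open import Data.Fin using (Fin; zero; suc; finToFun; funToFin; _≟_)
open import Data.Fin.Properties using (any?; all?; finToFun-funToFin)
open import Data.Fin.Subset using (Subset; inside; outside; _∈_; ∣_∣; ⊥)
open import Data.Fin.Subset.Properties using (_∈?_; anySubset?; ∣p∣≤n; ∉⊥)
open import Data.Vec using ([]; _∷_; tabulate; here; there)
open import Data.Vec.Properties using (lookup∘tabulate; []=⇒lookup)
open import Data.Product using (∃; ∃-syntax; _×_; _,_; proj₁; proj₂)
open import Function using (_∘_; id)
open import Level using (0ℓ)
open import Relation.Nullary using (¬_; Dec; yes; no; does; contradiction; ¬?)
open import Relation.Nullary.Decidable using (map′; _×-dec_; _→-dec_)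
open import Relation.Binary using (Rel; Symmetric; Irreflexive)
import Relation.Binary as B
import Relation.Unary as U
open import Relation.Binary.PropositionalEquality
  using (_≡_; _≢_; _≗_; refl; sym; trans; subst; subst₂)

------------------------------------------------------------------------
-- Least and greatest natural numbers with a given property

IsLeast : (ℕ → Set) → ℕ → Set
IsLeast P m = P m × (∀ {k} → P k → m ≤ k)

IsGreatest : (ℕ → Set) → ℕ → Set
IsGreatest P m = P m × (∀ {k} → P k → k ≤ m)

least : {P : ℕ → Set} → U.Decidable P → (b : ℕ) → P b → ∃ (IsLeast P)
least     P? zero    p = zero , p , λ _ → z≤n
least {P} P? (suc b) p with P? zero
... | yes p₀ = zero , p₀ , λ _ → z≤n
... | no ¬p₀ with least (P? ∘ suc) b p
...   | m , pm , min = suc m , pm , bound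
  where
  bound : ∀ {k} → P k → suc m ≤ k
  bound {zero}  q = contradiction q ¬p₀
  bound {suc k} q = s≤s (min q)

greatest : {P : ℕ → Set} → U.Decidable P → ∃ P →
           (b : ℕ) → (∀ {k} → P k → k ≤ b) → ∃ (IsGreatest P)
greatest {P} P? (a , pa) zero    bd = zero , subst P (ℕ.n≤0⇒n≡0 (bd pa)) pa , bd
greatest {P} P? ∃P       (suc b) bd with P? (suc b)
... | yes p = suc b , p , bd
... | no ¬p = greatest P? ∃P b
  (λ {k} q → s≤s⁻¹ (ℕ.≤∧≢⇒< (bd q) (λ { refl → ¬p q })))

------------------------------------------------------------------------
-- Finite simple graphs

record Graph (n : ℕ) : Set₁ where
  field
    Adj       : Rel (Fin n) 0ℓ
    adj?      : B.Decidable Adj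
    symmetric : Symmetric Adj
    loopless  : Irreflexive _≡_ Adj

open Graph public

module _ {n : ℕ} (G : Graph n) where

  neighbours : Fin n → Subset n
  neighbours v = tabulate (λ u → does (adj? G v u))

  degree : Fin n → ℕ
  degree v = ∣ neighbours v ∣

  Regular : ℕ → Set
  Regular k = ∀ v → degree v ≡ k

  ∈-neighbours⁻ : ∀ {v u} → u ∈ neighbours v → Adj G v u
  ∈-neighbours⁻ {v} {u} u∈
    with adj? G v u
       | trans (sym (lookup∘tabulate (λ u → does (adj? G v u)) u)) ([]=⇒lookup u∈)
  ... | yes a | _  = a
  ... | no  _ | ()

------------------------------------------------------------------------
-- Colourings

  Proper : ∀ {l} → (Fin n → Fin l) → Set
  Proper c = ∀ u v → Adj G u v → c u ≢ c v

  Dynamic : ∀ {l} → (Fin n → Fin l) → Set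
  Dynamic c = Proper c ×
    (∀ v → 2 ≤ degree v → ∃[ u ] ∃[ w ] Adj G v u × Adj G v w × c u ≢ c w)

  Colourable : ℕ → Set
  Colourable l = ∃[ c ] Proper {l} c

  DynamicallyColourable : ℕ → Set
  DynamicallyColourable l = ∃[ c ] Dynamic {l} c

------------------------------------------------------------------------
-- Independent sets

  Independent : Subset n → Set
  Independent S = ∀ u v → u ∈ S → v ∈ S → ¬ Adj G u v

  IndependentOfSize : ℕ → Set
  IndependentOfSize m = ∃[ S ] Independent S × ∣ S ∣ ≡ m

------------------------------------------------------------------------
-- Distance

  data Walk : Fin n → Fin n → ℕ → Set where
    []  : ∀ {u} → Walk u u 0
    _∷_ : ∀ {u v w m} → Adj G u v → Walk v w m → Walk u w (suc m)

  -- No d satisfies this when u and v lie in different components.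
  IsDistance : Fin n → Fin n → ℕ → Set
  IsDistance u v = IsLeast (Walk u v)

  Dist≤ : Fin n → Fin n → ℕ → Set
  Dist≤ u v m = ∃[ d ] IsDistance u v d × d ≤ m

------------------------------------------------------------------------
-- Decidability

private
  anyFunction? : ∀ {n l} {P : (Fin n → Fin l) → Set} →
                 (∀ {f g} → f ≗ g → P f → P g) → U.Decidable P → Dec (∃ P)
  anyFunction? resp P? = map′
    (λ (i , p) → finToFun i , p)
    (λ (f , p) → funToFin f , resp (sym ∘ finToFun-funToFin f) p)
    (any? (P? ∘ finToFun))

  two-elements : ∀ {n} (p : Subset n) → 2 ≤ ∣ p ∣ →
                 ∃[ u ] ∃[ w ] u ∈ p × w ∈ p × u ≢ w
  two-elements (outside ∷ p) h with two-elements p h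
  ... | u , w , u∈ , w∈ , u≢w =
    suc u , suc w , there u∈ , there w∈ , λ { refl → u≢w refl }
  two-elements (inside ∷ p) h with element p (s≤s⁻¹ h)
    where
    element : ∀ {n} (p : Subset n) → 1 ≤ ∣ p ∣ → ∃[ u ] u ∈ p
    element (inside  ∷ p) h = zero , here
    element (outside ∷ p) h with element p h
    ... | u , u∈ = suc u , there u∈
  ... | w , w∈ = zero , suc w , here , there w∈ , λ ()

module _ {n : ℕ} (G : Graph n) where

  proper? : ∀ {l} → U.Decidable (Proper G {l})
  proper? c = all? λ u → all? λ v → adj? G u v →-dec ¬? (c u ≟ c v)

  dynamic? : ∀ {l} → U.Decidable (Dynamic G {l})
  dynamic? c = proper? c ×-dec
    all? λ v → (2 ℕ.≤? degree G v) →-dec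
      any? λ u → any? λ w → adj? G v u ×-dec adj? G v w ×-dec ¬? (c u ≟ c w)

  private
    ≢-resp : ∀ {l} {f g : Fin n → Fin l} → f ≗ g → ∀ {u v} → f u ≢ f v → g u ≢ g v
    ≢-resp f≗g {u} {v} = subst₂ _≢_ (f≗g u) (f≗g v)

    proper-resp : ∀ {l} {f g : Fin n → Fin l} → f ≗ g → Proper G f → Proper G g
    proper-resp f≗g p u v a = ≢-resp f≗g (p u v a)

    dynamic-resp : ∀ {l} {f g : Fin n → Fin l} → f ≗ g → Dynamic G f → Dynamic G g
    dynamic-resp f≗g (p , d) = proper-resp f≗g p , λ v h →
      let u , w , a , b , ne = d v h in u , w , a , b , ≢-resp f≗g ne

  colourable? : U.Decidable (Colourable G)
  colourable? l = anyFunction? proper-resp proper?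

  dynamicallyColourable? : U.Decidable (DynamicallyColourable G)
  dynamicallyColourable? l = anyFunction? dynamic-resp dynamic?

  independent? : U.Decidable (Independent G)
  independent? S = all? λ u → all? λ v →
    (u ∈? S) →-dec (v ∈? S) →-dec ¬? (adj? G u v)

  independentOfSize? : U.Decidable (IndependentOfSize G)
  independentOfSize? m = anySubset? λ S → independent? S ×-dec (∣ S ∣ ℕ.≟ m)

  walk? : ∀ u v → U.Decidable (Walk G u v)
  walk? u v zero    = map′ (λ { refl → [] }) (λ { [] → refl }) (u ≟ v)
  walk? u w (suc m) = map′ (λ (v , a , p) → a ∷ p) (λ { (a ∷ p) → _ , a , p })
                           (any? λ v → adj? G u v ×-dec walk? v w m)

  short-walk⇒Dist≤ : ∀ {u v k m} → Walk G u v k → k ≤ m → Dist≤ G u v m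
  short-walk⇒Dist≤ {u} {v} p k≤m =
    let d , isDist = least (walk? u v) _ p
    in d , isDist , ℕ.≤-trans (proj₂ isDist p) k≤m

  dist≤? : ∀ u v → U.Decidable (Dist≤ G u v)
  dist≤? u v m = map′
    (λ (d , d<1+m , p) → short-walk⇒Dist≤ p (s≤s⁻¹ d<1+m))
    (λ (d , (p , _) , d≤m) → d , s≤s d≤m , p)
    (ℕ.anyUpTo? (walk? u v) (suc m))

  Walk-sym : ∀ {u v m} → Walk G u v m → Walk G v u m
  Walk-sym []      = []
  Walk-sym (a ∷ p) = snoc (Walk-sym p) (symmetric G a)
    where
    snoc : ∀ {u v w m} → Walk G u v m → Adj G v w → Walk G u w (suc m)
    snoc []      a = a ∷ []
    snoc (b ∷ p) a = b ∷ snoc p a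

  Dist≤-sym : ∀ {u v m} → Dist≤ G u v m → Dist≤ G v u m
  Dist≤-sym (_ , (p , _) , d≤m) = short-walk⇒Dist≤ (Walk-sym p) d≤m

------------------------------------------------------------------------
-- The square of a graph

square : ∀ {n} → Graph n → Graph n
square G = record
  { Adj       = λ u v → u ≢ v × Dist≤ G u v 2
  ; adj?      = λ u v → ¬? (u ≟ v) ×-dec dist≤? G u v 2
  ; symmetric = λ (u≢v , d) → u≢v ∘ sym , Dist≤-sym G d
  ; loopless  = λ u≡v (u≢v , _) → u≢v u≡v
  }

------------------------------------------------------------------------
-- Chromatic number, dynamic chromatic number, independence number

module _ {n : ℕ} (G : Graph n) where

  private
    id-proper : Proper G id
    id-proper u v a u≡v = loopless G u≡v a

    id-dynamic : Dynamic G id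
    id-dynamic = id-proper , λ v h →
      let u , w , u∈ , w∈ , u≢w = two-elements (neighbours G v) h
      in u , w , ∈-neighbours⁻ G u∈ , ∈-neighbours⁻ G w∈ , u≢w

  ∃-χ : ∃ (IsLeast (Colourable G))
  ∃-χ = least (colourable? G) n (id , id-proper)

  ∃-χ₂ : ∃ (IsLeast (DynamicallyColourable G))
  ∃-χ₂ = least (dynamicallyColourable? G) n (id , id-dynamic)

  ∃-α : ∃ (IsGreatest (IndependentOfSize G))
  ∃-α = greatest (independentOfSize? G)
    (_ , ⊥ , (λ _ _ u∈⊥ _ _ → ∉⊥ u∈⊥) , refl) n
    (λ { (S , _ , refl) → ∣p∣≤n S })

  χ χ₂ α : ℕ
  χ  = proj₁ ∃-χ
  χ₂ = proj₁ ∃-χ₂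
  α  = proj₁ ∃-α

{-# OPTIONS --safe #-}
module Submission where

-- Call a vertex bad for a proper colouring if its degree is at least 2 and all
-- its neighbours have the same colour. Starting from an optimal proper
-- colouring, bad vertices are removed with spare colours, each of them named
-- after a vertex; the names form an independent set of G in the first
-- statement, and of the square of G in the second.
--
-- Arbitrary graphs. While two bad vertices u and v are adjacent, v gets a spare
-- colour named v, and u an ordinary colour other than those of u and v. All
-- vertices in the closed neighbourhood of v are then good for ever, so that the
-- names are pairwise non-adjacent and not adjacent to later bad vertices. When
-- the bad vertices are independent, one neighbour of each bad vertex w gets a
-- spare colour named w (lemmas add-star and finish).
--
-- Regular graphs, of degree at least 2. The colouring may be assumed to be such
-- that each vertex of non-zero colour has a neighbour of colour 0. Let W be the
-- set of vertices whose neighbours all have colour 0; the other bad vertices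
-- have colour 0.
--
-- 1. If E is a set of vertices, and from each vertex some walk of length three
--    ends outside E, then the vertices can be given two labels so that both
--    labels occur on the neighbourhood of each w in E (lemma splitting). Indeed
--    double counting shows that each non-empty set U of vertices contains fewer
--    neighbourhoods of vertices in E than it has elements. So there is a
--    non-zero integer vector on U whose sum over each of these neighbourhoods is
--    zero, and its signs serve as labels, with induction on its zero set.
--
-- 2. Hence one spare colour for each colour a of a monochromatic neighbourhood is
--    enough: apply 1 to the bad vertices, and let the spare colour replace a on
--    one of the labels. Parts of the graph where all walks of odd length lead to
--    bad vertices are treated by changing the colours of a few adjacent pairs of
--    vertices (module Refine).
--
-- 3. Choose a bad vertex for each colour of a monochromatic neighbourhood. No two
--    of them have a common neighbour, and those with colour 0 are not adjacent.
--    So they are independent in the square, unless the one chosen in W is adjacent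
--    to another. The vertices of W can be painted with arbitrary non-zero
--    colours, of which there are at least three. This avoids the exception (modules Spread
--    and Several), except possibly when W has one element. In that case
--    either there are two vertices at distance at least three and only two colours
--    of monochromatic neighbourhoods, or another colouring with only one spare
--    colour is dynamic (module Single).

open import Defs
open import Data.Nat as ℕ using (ℕ; zero; suc; _+_; _*_; _^_; _≤_; _<_; z≤n; s≤s)
import Data.Nat.Properties as ℕ
open import Algebra.Properties.Semiring.Sum ℕ.+-*-semiring using (sum; sum-cong-≗; ∑-comm; *-distribˡ-sum; *-distribʳ-sum)
open import Data.Bool as Bool using (Bool; true; false; not; if_then_else_)
open import Data.Bool.Properties using (not-¬)
open import Data.Empty using () renaming (⊥ to Empty)
open import Data.Fin using (Fin; zero; suc; toℕ; fromℕ<; combine; finToFun; funToFin; splitAt; _≟_; _↑ˡ_; _↑ʳ_)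
open import Data.Fin.Patterns using (0F; 1F; 2F; 3F)
open import Data.Fin.Properties using (any?; all?; pigeonhole; finToFun-funToFin; funToFin-finToFin; ¬∀⟶∃¬; toℕ<n; toℕ-fromℕ<; toℕ-injective; <⇒≢; suc-injective; ↑ˡ-injective; ↑ʳ-injective; splitAt-↑ˡ; splitAt-↑ʳ)
open import Data.Fin.Subset using (Subset; inside; outside; _∈_; _∉_; _⊂_; _⊃_; _∪_; ∣_∣; ⊥; ⊤; ⁅_⁆)
open import Data.Fin.Subset.Induction using (⊂-wellFounded; ⊃-wellFounded; Acc; acc)
open import Data.Fin.Subset.Properties using (_∈?_; nonempty?; ∈⊤; ∉⊥; x∈⁅x⁆; x∈⁅y⁆⇒x≡y; x∈p∪q⁻; x∈p∪q⁺)
open import Data.List using (List; []; _∷_; filter; cartesianProduct; allFin)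
import Data.List.Membership.DecPropositional as DecList
import Data.List.Membership.Propositional as List
open import Data.List.Membership.Propositional.Properties using (∈-filter⁺; ∈-filter⁻; ∈-cartesianProduct⁺; ∈-allFin)
open import Data.List.Relation.Unary.Any as Any using (here; there)
open import Data.Product using (∃-syntax; ∃₂; _×_; _,_; proj₁; proj₂)
import Data.Product.Properties as Product
open import Data.Sum using (_⊎_; inj₁; inj₂; [_,_]′)
open import Data.Sum.Properties using (≡-dec; inj₁-injective; inj₂-injective)
open import Data.Unit using (tt)
open import Data.Vec using ([]; _∷_; tabulate; lookup; here; there)
open import Data.Vec.Properties using (lookup∘tabulate; []=⇒lookup; lookup⇒[]=)
open import Function using (_∘_)
open import Relation.Binary using (DecidableEquality; tri<; tri≈; tri>)
import Relation.Binary as B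
open import Relation.Binary.PropositionalEquality using (_≡_; _≢_; _≗_; refl; sym; trans; cong; cong₂; subst; module ≡-Reasoning)
open import Relation.Nullary using (¬_; Dec; yes; no; does; contradiction; ¬?)
open import Relation.Nullary.Decidable using (_×-dec_; _→-dec_; _⊎-dec_; decidable-stable; dec-true)
import Relation.Unary as U

------------------------------------------------------------------------
-- Finite sets

-- The set of the elements with a decidable property; neighbours G v is
-- subset (adj? G v) by definition.
subset : ∀ {n} {P : Fin n → Set} → U.Decidable P → Subset n
subset P? = tabulate (does ∘ P?)

∈-subset⁺ : ∀ {n} {P : Fin n → Set} (P? : U.Decidable P) {v} → P v → v ∈ subset P?
∈-subset⁺ P? {v} p = lookup⇒[]= v _ (trans (lookup∘tabulate (does ∘ P?) v) (dec-true (P? v) p))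

∈-subset⁻ : ∀ {n} {P : Fin n → Set} (P? : U.Decidable P) {v} → v ∈ subset P? → P v
∈-subset⁻ P? {v} v∈
  with P? v | trans (sym (lookup∘tabulate (does ∘ P?) v)) ([]=⇒lookup v∈)
... | yes p | _  = p
... | no  _ | ()

-- The elements of a set, in increasing order.
enum : ∀ {n} (p : Subset n) → Fin ∣ p ∣ → Fin n
enum (inside  ∷ p) zero    = zero
enum (inside  ∷ p) (suc j) = suc (enum p j)
enum (outside ∷ p) j       = suc (enum p j)

enum-∈ : ∀ {n} (p : Subset n) j → enum p j ∈ p
enum-∈ (inside  ∷ p) zero    = here
enum-∈ (inside  ∷ p) (suc j) = there (enum-∈ p j)
enum-∈ (outside ∷ p) j       = there (enum-∈ p j)

enum-injective : ∀ {n} (p : Subset n) {i j} → enum p i ≡ enum p j → i ≡ j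
enum-injective (inside  ∷ p) {zero}  {zero}  _  = refl
enum-injective (inside  ∷ p) {suc _} {suc _} eq = cong suc (enum-injective p (suc-injective eq))
enum-injective (outside ∷ p)                 eq = enum-injective p (suc-injective eq)

enum-surjective : ∀ {n} (p : Subset n) {v} → v ∈ p → ∃[ j ] enum p j ≡ v
enum-surjective (inside ∷ p) {zero} here = zero , refl
enum-surjective (inside ∷ p) {suc v} (there v∈) =
  let j , eq = enum-surjective p v∈ in suc j , cong suc eq
enum-surjective (outside ∷ p) {suc v} (there v∈) =
  let j , eq = enum-surjective p v∈ in j , cong suc eq

------------------------------------------------------------------------
-- Finite sums of natural numbers

-- The indicator function of a set.
[_]_ : ∀ {n} → Subset n → Fin n → ℕ
[ p ] v = if lookup p v then 1 else 0

[]-∈ : ∀ {n} {p : Subset n} {v} → v ∈ p → [ p ] v ≡ 1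
[]-∈ v∈p = cong (if_then 1 else 0) ([]=⇒lookup v∈p)

[]-∉ : ∀ {n} (p : Subset n) {v} → v ∉ p → [ p ] v ≡ 0
[]-∉ p {v} v∉p with lookup p v in eq
... | true  = contradiction (lookup⇒[]= v p eq) v∉p
... | false = refl

[]≤1 : ∀ {n} (p : Subset n) v → [ p ] v ≤ 1
[]≤1 p v with lookup p v
... | true  = ℕ.≤-refl
... | false = z≤n

∣∣≡sum : ∀ {n} (p : Subset n) → ∣ p ∣ ≡ sum [ p ]_
∣∣≡sum []            = refl
∣∣≡sum (inside  ∷ p) = cong suc (∣∣≡sum p)
∣∣≡sum (outside ∷ p) = ∣∣≡sum p

sum-mono-≤ : ∀ {n} {f g : Fin n → ℕ} → (∀ i → f i ≤ g i) → sum f ≤ sum g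
sum-mono-≤ {zero}  h = z≤n
sum-mono-≤ {suc n} h = ℕ.+-mono-≤ (h zero) (sum-mono-≤ (h ∘ suc))

sum-mono-< : ∀ {n} {f g : Fin n → ℕ} → (∀ i → f i ≤ g i) →
             ∀ i → f i < g i → sum f < sum g
sum-mono-< h zero    lt = ℕ.+-mono-<-≤ lt (sum-mono-≤ (h ∘ suc))
sum-mono-< h (suc i) lt = ℕ.+-mono-≤-< (h zero) (sum-mono-< (h ∘ suc) i lt)

sum-bound : ∀ {n} {f : Fin n → ℕ} b → (∀ i → f i ≤ b) → sum f ≤ n * b
sum-bound {zero}  b h = z≤n
sum-bound {suc n} b h = ℕ.+-mono-≤ (h zero) (sum-bound b (h ∘ suc))

-- The function with the given values along the enumeration of a set, and 0
-- outside the set.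
extend : ∀ {n} (p : Subset n) → (Fin ∣ p ∣ → ℕ) → Fin n → ℕ
extend (inside  ∷ p) φ zero    = φ zero
extend (inside  ∷ p) φ (suc v) = extend p (φ ∘ suc) v
extend (outside ∷ p) φ zero    = 0
extend (outside ∷ p) φ (suc v) = extend p φ v

extend-enum : ∀ {n} (p : Subset n) φ j → extend p φ (enum p j) ≡ φ j
extend-enum (inside  ∷ p) φ zero    = refl
extend-enum (inside  ∷ p) φ (suc j) = extend-enum p (φ ∘ suc) j
extend-enum (outside ∷ p) φ j       = extend-enum p φ j

extend-∉ : ∀ {n} (p : Subset n) φ {v} → v ∉ p → extend p φ v ≡ 0
extend-∉ (inside  ∷ p) φ {zero}  v∉ = contradiction here v∉
extend-∉ (inside  ∷ p) φ {suc v} v∉ = extend-∉ p (φ ∘ suc) (v∉ ∘ there)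
extend-∉ (outside ∷ p) φ {zero}  v∉ = refl
extend-∉ (outside ∷ p) φ {suc v} v∉ = extend-∉ p φ (v∉ ∘ there)

extend-≤ : ∀ {n} (p : Subset n) φ {b} → (∀ j → φ j ≤ b) → ∀ v → extend p φ v ≤ b
extend-≤ (inside  ∷ p) φ h zero    = h zero
extend-≤ (inside  ∷ p) φ h (suc v) = extend-≤ p (φ ∘ suc) (h ∘ suc) v
extend-≤ (outside ∷ p) φ h zero    = z≤n
extend-≤ (outside ∷ p) φ h (suc v) = extend-≤ p φ h v

-- The sum of a weight over a set.
sumOver : ∀ {n} → Subset n → (Fin n → ℕ) → ℕ
sumOver p f = sum (λ v → [ p ] v * f v)

sumOver-≤ : ∀ {n} (p : Subset n) f {b} → (∀ v → f v ≤ b) → sumOver p f ≤ n * b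
sumOver-≤ p f {b} h = sum-bound b λ v →
  ℕ.≤-trans (ℕ.*-mono-≤ ([]≤1 p v) (h v)) (ℕ.≤-reflexive (ℕ.*-identityˡ b))

^-distrib-* : ∀ a b m → (a * b) ^ m ≡ a ^ m * b ^ m
^-distrib-* a b zero    = refl
^-distrib-* a b (suc m) = trans (cong (a * b *_) (^-distrib-* a b m))
  (ℕ.[m*n]*[o*p]≡[m*o]*[n*p] a b (a ^ m) (b ^ m))

funToFin-cong : ∀ {m N} {f g : Fin m → Fin N} → f ≗ g → funToFin f ≡ funToFin g
funToFin-cong {zero}  eq = refl
funToFin-cong {suc m} eq = cong₂ combine (eq zero) (funToFin-cong (eq ∘ suc))

------------------------------------------------------------------------
-- Integer solutions of underdetermined systems

-- Siegel's pigeonhole argument: a homogeneous linear system with coefficients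
-- 0 and 1, with one equation for each w in E and one unknown for each v in U,
-- has a non-trivial integer solution if it has fewer equations than unknowns.
-- The solution is given as a difference of two natural weights f and g.
siegel : ∀ {n} (A : Fin n → Subset n) (E U : Subset n) → ∣ E ∣ < ∣ U ∣ →
         ∃₂ λ (f g : Fin n → ℕ) →
           (∀ {v} → v ∉ U → f v ≡ g v) × (∃[ v ] f v ≢ g v) ×
           (∀ {w} → w ∈ E → sumOver (A w) f ≡ sumOver (A w) g)
siegel {n} A E U E<U = weight i , weight j , agree , differ , balanced
  where
  m b N M : ℕ
  m = ∣ E ∣
  -- Weights run over 0, ..., b. A sum of n weights is below M = (n + 1) N, and
  -- b is chosen so that M ^ m < N ^ (m + 1).
  b = suc n ^ m
  N = suc b
  M = suc n * N

  fewer : M ^ m < N ^ ∣ U ∣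
  fewer = begin-strict
    (suc n * N) ^ m    ≡⟨ ^-distrib-* (suc n) N m ⟩
    suc n ^ m * N ^ m  <⟨ ℕ.*-monoˡ-< (N ^ m) {{ℕ.m^n≢0 N m}} {b} {N} (ℕ.n<1+n b) ⟩
    N * N ^ m          ≤⟨ ℕ.^-monoʳ-≤ N E<U ⟩
    N ^ ∣ U ∣          ∎
    where open ℕ.≤-Reasoning

  weight : Fin (N ^ ∣ U ∣) → Fin n → ℕ
  weight i = extend U (toℕ ∘ finToFun {N} {∣ U ∣} i)

  sums< : ∀ i w → sumOver (A w) (weight i) < M
  sums< i w = ℕ.<-≤-trans
    (s≤s (sumOver-≤ (A w) (weight i)
           (extend-≤ U _ (ℕ.s≤s⁻¹ ∘ toℕ<n ∘ finToFun {N} {∣ U ∣} i))))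
    (ℕ.+-mono-≤ (s≤s z≤n) (ℕ.*-monoʳ-≤ n (ℕ.n≤1+n b)))

  sums : Fin (N ^ ∣ U ∣) → Fin m → Fin M
  sums i e = fromℕ< (sums< i (enum E e))

  collision = pigeonhole fewer (funToFin ∘ sums)
  i = proj₁ collision
  j = proj₁ (proj₂ collision)
  i<j = proj₁ (proj₂ (proj₂ collision))

  agree : ∀ {v} → v ∉ U → weight i v ≡ weight j v
  agree v∉U = trans (extend-∉ U _ v∉U) (sym (extend-∉ U _ v∉U))

  differ : ∃[ v ] weight i v ≢ weight j v
  differ = ¬∀⟶∃¬ n _ (λ v → weight i v ℕ.≟ weight j v) λ same → <⇒≢ i<j
    (trans (sym (funToFin-finToFin {∣ U ∣} {N} i))
    (trans (funToFin-cong (λ e → toℕ-injective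
             (trans (sym (extend-enum U _ e)) (trans (same (enum U e)) (extend-enum U _ e)))))
           (funToFin-finToFin {∣ U ∣} {N} j)))

  balanced : ∀ {w} → w ∈ E → sumOver (A w) (weight i) ≡ sumOver (A w) (weight j)
  balanced w∈E with e , refl ← enum-surjective E w∈E = begin
    sumOver (A _) (weight i)  ≡⟨ toℕ-fromℕ< (sums< i _) ⟨
    toℕ (sums i e)            ≡⟨ cong toℕ same ⟩
    toℕ (sums j e)            ≡⟨ toℕ-fromℕ< (sums< j _) ⟩
    sumOver (A _) (weight j)  ∎
    where
    open ≡-Reasoning
    same : sums i e ≡ sums j e
    same = trans (sym (finToFun-funToFin (sums i) e))
      (trans (cong (λ z → finToFun {M} {m} z e) (proj₂ (proj₂ (proj₂ collision))))
             (finToFun-funToFin (sums j) e))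

------------------------------------------------------------------------
-- Splitting neighbourhoods with two labels

module _ {n : ℕ} (G : Graph n) where

  ∈-neighbours⁺ : ∀ {v u} → Adj G v u → u ∈ neighbours G v
  ∈-neighbours⁺ {v} = ∈-subset⁺ (adj? G v)

  neighbour : ∀ {v} → 1 ≤ degree G v → ∃[ u ] Adj G v u
  neighbour {v} 1≤ = let p = neighbours G v; j = fromℕ< 1≤ in
    enum p j , ∈-neighbours⁻ G (enum-∈ p j)

  another : ∀ {v} → 2 ≤ degree G v → ∀ u → ∃[ q ] Adj G v q × q ≢ u
  another {v} 2≤ u = pick (enum p i ≟ u)
    where
    p = neighbours G v
    i j : Fin ∣ p ∣
    i = fromℕ< (ℕ.≤-trans (s≤s z≤n) 2≤)
    j = fromℕ< 2≤
    i≢j : i ≢ j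
    i≢j eq with () ← trans (sym (toℕ-fromℕ< _)) (trans (cong toℕ eq) (toℕ-fromℕ< _))
    pick : Dec (enum p i ≡ u) → ∃[ q ] Adj G v q × q ≢ u
    pick (no  ≢u) = enum p i , ∈-neighbours⁻ G (enum-∈ p i) , ≢u
    pick (yes ≡u) = enum p j , ∈-neighbours⁻ G (enum-∈ p j) ,
      λ ≡u′ → i≢j (enum-injective p (trans ≡u (sym ≡u′)))

  -- From every vertex some walk of length three ends outside E.
  Escapes : Subset n → Set
  Escapes E = ∀ x → ∃[ w ] ∃[ x′ ] ∃[ w′ ] Adj G x w × Adj G w x′ × Adj G x′ w′ × w′ ∉ E

  within? : (E U : Subset n) → U.Decidable (λ w → w ∈ E × (∀ x → Adj G w x → x ∈ U))
  within? E U w = (w ∈? E) ×-dec all? λ x → adj? G w x →-dec (x ∈? U)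

  -- The vertices of E whose neighbourhood is contained in U.
  within : (E U : Subset n) → Subset n
  within E U = subset (within? E U)

  -- The pairs (w , x) with w in F = within E U and x a neighbour of w are among
  -- the pairs with x in U and w a neighbour of x, and some pair of the second
  -- kind has w outside F. There are k + 1 pairs of the first kind for each vertex
  -- of F, and k + 1 pairs of the second kind for each vertex of U.
  few-within : ∀ {k} → Regular G (suc k) → ∀ {E} → Escapes E →
               ∀ U {x} → x ∈ U → ∣ within E U ∣ < ∣ U ∣
  few-within {k} reg {E} esc U {x₀} x₀∈U = ℕ.*-cancelʳ-< (suc k) _ _ (begin-strict
    ∣ F ∣ * suc k                            ≡⟨ scaled F ⟩
    sum (λ w → sum (λ x → [ F ] w * a w x))  <⟨ sum-mono-< (λ w → sum-mono-≤ (le w)) (proj₁ leak) atLeak ⟩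
    sum (λ w → sum (λ x → [ U ] x * a x w))  ≡⟨ ∑-comm (λ w x → [ U ] x * a x w) ⟩
    sum (λ x → sum (λ w → [ U ] x * a x w))  ≡⟨ scaled U ⟨
    ∣ U ∣ * suc k                            ∎)
    where
    open ℕ.≤-Reasoning
    F = within E U
    a : Fin n → Fin n → ℕ
    a v = [ neighbours G v ]_

    scaled : ∀ p → ∣ p ∣ * suc k ≡ sum (λ w → sum (λ x → [ p ] w * a w x))
    scaled p = ≡.begin
      ∣ p ∣ * suc k                            ≡.≡⟨ cong (_* suc k) (∣∣≡sum p) ⟩
      sum [ p ]_ * suc k                       ≡.≡⟨ *-distribʳ-sum (suc k) [ p ]_ ⟩
      sum (λ w → [ p ] w * suc k)              ≡.≡⟨ sum-cong-≗ (λ w → trans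
          (cong ([ p ] w *_) (trans (sym (reg w)) (∣∣≡sum (neighbours G w))))
          (*-distribˡ-sum ([ p ] w) (a w))) ⟩
      sum (λ w → sum (λ x → [ p ] w * a w x)) ≡.∎
      where module ≡ = ≡-Reasoning

    le : ∀ w x → [ F ] w * a w x ≤ [ U ] x * a x w
    le w x with w ∈? F | adj? G w x
    ... | no w∉F | _ rewrite []-∉ F w∉F = z≤n
    ... | yes _ | no ¬wx rewrite []-∉ (neighbours G w) (¬wx ∘ ∈-neighbours⁻ G) | ℕ.*-zeroʳ ([ F ] w) = z≤n
    ... | yes w∈F | yes wx
      rewrite []-∈ (proj₂ (∈-subset⁻ (within? E U) w∈F) x wx)
            | []-∈ (∈-neighbours⁺ (symmetric G wx)) =
      ℕ.*-mono-≤ ([]≤1 F w) ([]≤1 (neighbours G w) x)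

    -- If all neighbours of vertices of U were in F, a walk of odd length that
    -- starts in U could not leave E.
    leak : ∃[ w ] w ∉ F × ∃[ x ] x ∈ U × Adj G x w
    leak with any? (λ w → ¬? (w ∈? F) ×-dec any? (λ x → (x ∈? U) ×-dec adj? G x w))
    ... | yes found = found
    ... | no  none  =
      let w , x , w′ , x₀w , wx , xw′ , w′∉E = esc x₀
          stays : ∀ {x w} → x ∈ U → Adj G x w → w ∈ F
          stays x∈U xw = decidable-stable (_ ∈? F) λ w∉F → none (_ , w∉F , _ , x∈U , xw)
          inE×U = λ {w} (w∈F : w ∈ F) → ∈-subset⁻ (within? E U) {w} w∈F
          x∈U = proj₂ (inE×U (stays x₀∈U x₀w)) x wx
      in contradiction (proj₁ (inE×U (stays x∈U xw′))) w′∉E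

    atLeak : sum (λ x → [ F ] (proj₁ leak) * a (proj₁ leak) x) < sum (λ x → [ U ] x * a x (proj₁ leak))
    atLeak with leak
    ... | w , w∉F , x , x∈U , xw = sum-mono-< (le w) x (ℕ.≤-reflexive
      (trans (cong (λ z → suc (z * a w x)) ([]-∉ F w∉F))
             (sym (cong₂ _*_ ([]-∈ x∈U) ([]-∈ (∈-neighbours⁺ xw))))))

  -- Two neighbours of w have different labels.
  Splits : (Fin n → Bool) → Fin n → Set
  Splits s w = ∃[ x ] ∃[ x′ ] Adj G w x × Adj G w x′ × s x ≢ s x′

  private
    -- A weight that is smaller at some neighbour is larger at another.
    balance : ∀ {w} f g → sumOver (neighbours G w) f ≡ sumOver (neighbours G w) g →
              ∀ {x} → Adj G w x → f x < g x → ∃[ x′ ] Adj G w x′ × g x′ < f x′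
    balance {w} f g eq {x} wx lt with any? (λ x′ → adj? G w x′ ×-dec (g x′ ℕ.<? f x′))
    ... | yes found = found
    ... | no  none  = contradiction eq (ℕ.<⇒≢ (sum-mono-< le x strictly))
      where
      le : ∀ v → [ neighbours G w ] v * f v ≤ [ neighbours G w ] v * g v
      le v with adj? G w v
      ... | yes wv = ℕ.*-monoʳ-≤ ([ neighbours G w ] v) (ℕ.≮⇒≥ λ gt → none (v , wv , gt))
      ... | no ¬wv rewrite []-∉ (neighbours G w) (¬wv ∘ ∈-neighbours⁻ G) = z≤n
      strictly : [ neighbours G w ] x * f x < [ neighbours G w ] x * g x
      strictly rewrite []-∈ (∈-neighbours⁺ wx) | ℕ.*-identityˡ (f x) | ℕ.*-identityˡ (g x) = lt

    -- Induction on U. Let the weights f and g on U have equal sums over the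
    -- neighbourhood of each w in within E U. Label v by the sign of f v - g v,
    -- and label the set T of ties by induction. If f and g differ somewhere on
    -- the neighbourhood of w, then both signs occur there; otherwise the
    -- neighbourhood is contained in T.
    splitting-within : ∀ {k} → Regular G (suc k) → ∀ {E} → Escapes E → ∀ U → Acc _⊂_ U →
                       ∃[ s ] ∀ {w} → w ∈ within E U → Splits s w
    splitting-within reg {E} esc U (acc rec) with nonempty? U
    ... | no empty = (λ _ → true) , λ {w} w∈ →
      let x , wx = neighbour (subst (1 ≤_) (sym (reg w)) (s≤s z≤n))
      in contradiction (x , proj₂ (∈-subset⁻ (within? E U) w∈) x wx) empty
    ... | yes (_ , v₀∈U)
      with f , g , agree , (v , fv≢gv) , balanced ← siegel (neighbours G) (within E U) U (few-within reg esc U v₀∈U)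
      = s , splits
      where
      tied? : U.Decidable (λ v → v ∈ U × f v ≡ g v)
      tied? v = (v ∈? U) ×-dec (f v ℕ.≟ g v)
      T = subset tied?

      T⊂U : T ⊂ U
      T⊂U = proj₁ ∘ ∈-subset⁻ tied? , v ,
        decidable-stable (v ∈? U) (λ v∉U → fv≢gv (agree v∉U)) ,
        fv≢gv ∘ proj₂ ∘ ∈-subset⁻ tied?

      inner = splitting-within reg esc T (rec T⊂U)

      s : Fin n → Bool
      s v with ℕ.<-cmp (f v) (g v)
      ... | tri< _ _ _ = true
      ... | tri≈ _ _ _ = proj₁ inner v
      ... | tri> _ _ _ = false

      s-< : ∀ {v} → f v < g v → s v ≡ true
      s-< {v} lt with ℕ.<-cmp (f v) (g v)
      ... | tri< _ _ _  = refl
      ... | tri≈ ≮ _ _ = contradiction lt ≮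
      ... | tri> ≮ _ _ = contradiction lt ≮

      s-> : ∀ {v} → g v < f v → s v ≡ false
      s-> {v} gt with ℕ.<-cmp (f v) (g v)
      ... | tri< _ _ ≯  = contradiction gt ≯
      ... | tri≈ _ _ ≯ = contradiction gt ≯
      ... | tri> _ _ _ = refl

      s-≡ : ∀ {v} → f v ≡ g v → s v ≡ proj₁ inner v
      s-≡ {v} eq with ℕ.<-cmp (f v) (g v)
      ... | tri< _ ≢ _ = contradiction eq ≢
      ... | tri≈ _ _ _ = refl
      ... | tri> _ ≢ _ = contradiction eq ≢

      opposite : ∀ {x y} → f x < g x → g y < f y → s x ≢ s y
      opposite lt gt eq with () ← trans (sym (s-< lt)) (trans eq (s-> gt))

      splits : ∀ {w} → w ∈ within E U → Splits s w
      splits {w} w∈ with any? (λ x → adj? G w x ×-dec ¬? (f x ℕ.≟ g x))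
      ... | no all-tied =
        let w∈E , N⊆U = ∈-subset⁻ (within? E U) w∈
            tied : ∀ {x} → Adj G w x → f x ≡ g x
            tied wx = decidable-stable (f _ ℕ.≟ g _) λ ≢ → all-tied (_ , wx , ≢)
            x , y , wx , wy , ≢ = proj₂ inner (∈-subset⁺ (within? E T)
              (w∈E , λ x wx → ∈-subset⁺ tied? (N⊆U x wx , tied wx)))
        in x , y , wx , wy , λ eq → ≢ (trans (sym (s-≡ (tied wx))) (trans eq (s-≡ (tied wy))))
      ... | yes (x , wx , ≢) with ℕ.<-cmp (f x) (g x)
      ...   | tri< lt _ _ =
        let y , wy , gt = balance f g (balanced w∈) wx lt in x , y , wx , wy , opposite lt gt
      ...   | tri≈ _ eq _ = contradiction eq ≢
      ...   | tri> _ _ gt =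
        let y , wy , lt = balance g f (sym (balanced w∈)) wx gt in y , x , wy , wx , opposite lt gt

  abstract

    -- In a regular graph of positive degree, if every vertex has a walk of
    -- length three that ends outside E, then some labelling of the vertices by
    -- two labels splits the neighbourhoods of all vertices in E. The labelling
    -- is abstract to keep it folded in later goals.
    splitting : ∀ {k} → Regular G (suc k) → ∀ {E} → Escapes E →
                ∃[ s ] ∀ {w} → w ∈ E → Splits s w
    splitting reg {E} esc =
      let s , splits = splitting-within reg esc ⊤ (⊂-wellFounded ⊤)
      in s , λ w∈E → splits (∈-subset⁺ (within? E ⊤) (w∈E , λ _ _ → ∈⊤))

------------------------------------------------------------------------
-- Colourings with spare colours named after vertices

-- A colour is either one of l ordinary colours or a spare colour, named after
-- a vertex.
_≟ᶜ_ : ∀ {l n} → DecidableEquality (Fin l ⊎ Fin n)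
_≟ᶜ_ = ≡-dec _≟_ _≟_

recolour : ∀ {n} {C : Set} → (Fin n → C) → Fin n → C → Fin n → C
recolour c v k x with x ≟ v
... | yes _ = k
... | no  _ = c x

recolour-same : ∀ {n} {C : Set} (c : Fin n → C) v k → recolour c v k v ≡ k
recolour-same c v k with v ≟ v
... | yes _  = refl
... | no v≢v = contradiction refl v≢v

recolour-other : ∀ {n} {C : Set} (c : Fin n → C) v k {x} → x ≢ v → recolour c v k x ≡ c x
recolour-other c v k {x} x≢v with x ≟ v
... | yes x≡v = contradiction x≡v x≢v
... | no _    = refl

module _ {n : ℕ} (G : Graph n) where

  -- At least two colours appear on the neighbours of v.
  TwoColoured : {C : Set} → (Fin n → C) → Fin n → Set
  TwoColoured c v = ∃[ u ] ∃[ w ] Adj G v u × Adj G v w × c u ≢ c w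

  twoColoured? : {C : Set} → DecidableEquality C → (c : Fin n → C) → U.Decidable (TwoColoured c)
  twoColoured? _≟_ c v = any? λ u → any? λ w → adj? G v u ×-dec adj? G v w ×-dec ¬? (c u ≟ c w)

  recolour-proper : {C : Set} {c : Fin n → C} → (∀ u v → Adj G u v → c u ≢ c v) →
                    ∀ v {k} → (∀ u → Adj G v u → c u ≢ k) →
                    ∀ x y → Adj G x y → recolour c v k x ≢ recolour c v k y
  recolour-proper proper v ok x y xy with x ≟ v | y ≟ v
  ... | yes refl | yes refl = contradiction xy (loopless G refl)
  ... | yes refl | no _     = ok y xy ∘ sym
  ... | no _     | yes refl = ok x (symmetric G xy)
  ... | no _     | no _     = proper x y xy

  -- If only spare colours named after elements of S are used, then l + ∣ S ∣
  -- colours are enough.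
  encode : ∀ {l} (S : Subset n) (k : Fin l ⊎ Fin n) → (∀ s → k ≡ inj₂ s → s ∈ S) → Fin (l + ∣ S ∣)
  encode     S (inj₁ a) h = a ↑ˡ ∣ S ∣
  encode {l} S (inj₂ s) h = l ↑ʳ proj₁ (enum-surjective S (h _ refl))

  encode-injective : ∀ {l} (S : Subset n) (k k′ : Fin l ⊎ Fin n) h h′ → encode S k h ≡ encode S k′ h′ → k ≡ k′
  encode-injective S (inj₁ a) (inj₁ b) h h′ eq = cong inj₁ (↑ˡ-injective ∣ S ∣ a b eq)
  encode-injective {l} S (inj₁ a) (inj₂ t) h h′ eq
    with () ← trans (sym (splitAt-↑ˡ l a ∣ S ∣)) (trans (cong (splitAt l) eq) (splitAt-↑ʳ l ∣ S ∣ _))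
  encode-injective {l} S (inj₂ s) (inj₁ b) h h′ eq
    with () ← trans (sym (splitAt-↑ˡ l b ∣ S ∣)) (trans (cong (splitAt l) (sym eq)) (splitAt-↑ʳ l ∣ S ∣ _))
  encode-injective {l} S (inj₂ s) (inj₂ t) h h′ eq =
    let i , i≡ = enum-surjective S (h _ refl); j , j≡ = enum-surjective S (h′ _ refl)
    in cong inj₂ (trans (sym i≡) (trans (cong (enum S) (↑ʳ-injective l i j eq)) j≡))

  dynamicallyColourable : ∀ {l} (S : Subset n) (c : Fin n → Fin l ⊎ Fin n) →
    (∀ {v s} → c v ≡ inj₂ s → s ∈ S) → (∀ u v → Adj G u v → c u ≢ c v) →
    (∀ v → 2 ≤ degree G v → TwoColoured c v) → DynamicallyColourable G (l + ∣ S ∣)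
  dynamicallyColourable S c named proper two =
    (λ v → encode S (c v) (λ _ → named)) ,
    (λ u v uv eq → proper u v uv (encode-injective S _ _ (λ _ → named) (λ _ → named) eq)) ,
    λ v 2≤ → let u , w , vu , vw , ≢ = two v 2≤
             in u , w , vu , vw , ≢ ∘ encode-injective S _ _ (λ _ → named) (λ _ → named)

  χ₂≤ : ∀ {m} → DynamicallyColourable G m → χ₂ G ≤ m
  χ₂≤ = proj₂ (proj₂ (∃-χ₂ G))

  χ-colouring : Colourable G (χ G)
  χ-colouring = proj₁ (proj₂ (∃-χ G))

  ∣∣≤α : ∀ {S} → Independent G S → ∣ S ∣ ≤ α G
  ∣∣≤α {S} ind = proj₂ (proj₂ (∃-α G)) (S , ind , refl)

------------------------------------------------------------------------
-- Arbitrary graphs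

avoid-two : ∀ {m} (a b : Fin (3 + m)) → ∃[ d ] d ≢ a × d ≢ b
avoid-two 0F            0F            = 1F , (λ ()) , (λ ())
avoid-two 0F            1F            = 2F , (λ ()) , (λ ())
avoid-two 0F            (suc (suc _)) = 1F , (λ ()) , (λ ())
avoid-two 1F            0F            = 2F , (λ ()) , (λ ())
avoid-two (suc (suc _)) 0F            = 1F , (λ ()) , (λ ())
avoid-two (suc _)       (suc _)       = 0F , (λ ()) , (λ ())

module _ {n m : ℕ} (G : Graph n) where

  private
    Colour : Set
    Colour = Fin (3 + m) ⊎ Fin n

  -- A proper colouring in which each vertex s in S, and no other vertex, has a
  -- spare colour, the one named s.
  record Starred (S : Subset n) : Set where
    field
      c           : Fin n → Colour
      proper      : ∀ u v → Adj G u v → c u ≢ c v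
      starred     : ∀ {s} → s ∈ S → c s ≡ inj₂ s
      star⇒       : ∀ {v s} → c v ≡ inj₂ s → v ≡ s × s ∈ S
      independent : Independent G S
      twoColoured : ∀ {s} → s ∈ S → TwoColoured G c s

    -- The vertices that violate the dynamic condition.
    Bad : Fin n → Set
    Bad v = 2 ≤ degree G v × ¬ TwoColoured G c v

    bad? : U.Decidable Bad
    bad? v = (2 ℕ.≤? degree G v) ×-dec ¬? (twoColoured? G _≟ᶜ_ c v)

    bad⇒∉S : ∀ {v} → Bad v → v ∉ S
    bad⇒∉S (_ , mono) v∈S = mono (twoColoured v∈S)

    bad⇒unstarred : ∀ {v} → Bad v → ∃[ a ] c v ≡ inj₁ a
    bad⇒unstarred {v} bad with c v in eq
    ... | inj₁ a = a , refl
    ... | inj₂ s with refl , s∈S ← star⇒ eq = contradiction s∈S (bad⇒∉S bad)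

    -- A neighbour of s in S sees the colour of s only at s.
    bad⇒≁S : ∀ {v s} → Bad v → s ∈ S → ¬ Adj G v s
    bad⇒≁S {v} {s} (2≤ , mono) s∈S vs =
      let q , vq , q≢s = another G 2≤ s
      in mono (s , q , vs , vq , λ eq → q≢s (proj₁ (star⇒ (trans (sym eq) (starred s∈S)))))

    mono : ∀ {v u w} → Bad v → Adj G v u → Adj G v w → c u ≡ c w
    mono {v} {u} {w} (_ , ¬two) vu vw =
      decidable-stable (c u ≟ᶜ c w) λ ≢ → ¬two (u , w , vu , vw , ≢)

  open Starred

  -- Let u and v be adjacent bad vertices, with colours a and b; then all
  -- neighbours of u have colour b and all neighbours of v have colour a. Give v
  -- its own spare colour, and u a colour d other than a and b. Now v sees d at u
  -- and a at its other neighbours.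
  add-star : ∀ {S} (st : Starred S) {u v} → Bad st u → Bad st v → Adj G u v → Starred (S ∪ ⁅ v ⁆)
  add-star {S} st {u} {v} bad-u bad-v uv = record
    { c           = c″
    ; proper      = recolour-proper G proper′ v fresh
    ; starred     = starred″
    ; star⇒       = star⇒″
    ; independent = independent″
    ; twoColoured = two″
    }
    where
    a b d : Fin (3 + m)
    a = proj₁ (bad⇒unstarred st bad-u)
    b = proj₁ (bad⇒unstarred st bad-v)
    d = proj₁ (avoid-two a b)
    d≢a : d ≢ a
    d≢a = proj₁ (proj₂ (avoid-two a b))
    d≢b : d ≢ b
    d≢b = proj₂ (proj₂ (avoid-two a b))
    cu≡a = proj₂ (bad⇒unstarred st bad-u)
    cv≡b = proj₂ (bad⇒unstarred st bad-v)

    c′ c″ : Fin n → Colour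
    c′ = recolour (c st) u (inj₁ d)
    c″ = recolour c′ v (inj₂ v)

    proper′ : ∀ x y → Adj G x y → c′ x ≢ c′ y
    proper′ = recolour-proper G (proper st) u λ y uy eq →
      d≢b (inj₁-injective (trans (sym eq) (trans (mono st bad-u uy uv) cv≡b)))

    c′≢star : ∀ {x} → c′ x ≢ inj₂ v
    c′≢star {x} eq with x ≟ u
    ... | yes _ with () ← eq
    ... | no  _ = bad⇒∉S st bad-v (proj₂ (star⇒ st eq))

    fresh : ∀ x → Adj G v x → c′ x ≢ inj₂ v
    fresh x _ = c′≢star {x}

    unchanged : ∀ {x} → x ≢ u → x ≢ v → c″ x ≡ c st x
    unchanged x≢u x≢v = trans (recolour-other c′ v _ x≢v) (recolour-other (c st) u _ x≢u)

    starred″ : ∀ {s} → s ∈ S ∪ ⁅ v ⁆ → c″ s ≡ inj₂ s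
    starred″ {s} s∈ with x∈p∪q⁻ S ⁅ v ⁆ s∈
    ... | inj₂ s∈v with refl ← x∈⁅y⁆⇒x≡y v s∈v = recolour-same c′ v _
    ... | inj₁ s∈S = trans
      (unchanged (λ { refl → bad⇒∉S st bad-u s∈S }) (λ { refl → bad⇒∉S st bad-v s∈S }))
      (starred st s∈S)

    star⇒″ : ∀ {x s} → c″ x ≡ inj₂ s → x ≡ s × s ∈ S ∪ ⁅ v ⁆
    star⇒″ {x} eq with x ≟ v
    ... | yes refl with refl ← eq = refl , x∈p∪q⁺ (inj₂ (x∈⁅x⁆ v))
    ... | no  _ with x ≟ u
    ...   | yes _ with () ← eq
    ...   | no  _ = let x≡s , s∈S = star⇒ st eq in x≡s , x∈p∪q⁺ (inj₁ s∈S)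

    independent″ : Independent G (S ∪ ⁅ v ⁆)
    independent″ x y x∈ y∈ xy with x∈p∪q⁻ S ⁅ v ⁆ x∈ | x∈p∪q⁻ S ⁅ v ⁆ y∈
    ... | inj₁ x∈S | inj₁ y∈S = independent st x y x∈S y∈S xy
    ... | inj₁ x∈S | inj₂ y∈v with refl ← x∈⁅y⁆⇒x≡y v y∈v = bad⇒≁S st bad-v x∈S (symmetric G xy)
    ... | inj₂ x∈v | inj₁ y∈S with refl ← x∈⁅y⁆⇒x≡y v x∈v = bad⇒≁S st bad-v y∈S xy
    ... | inj₂ x∈v | inj₂ y∈v = loopless G (trans (x∈⁅y⁆⇒x≡y v x∈v) (sym (x∈⁅y⁆⇒x≡y v y∈v))) xy

    two″ : ∀ {s} → s ∈ S ∪ ⁅ v ⁆ → TwoColoured G c″ s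
    two″ {s} s∈ with x∈p∪q⁻ S ⁅ v ⁆ s∈
    ... | inj₁ s∈S =
      let p , q , sp , sq , ≢ = twoColoured st s∈S
          kept : ∀ {x} → Adj G s x → c″ x ≡ c st x
          kept sx = unchanged (λ { refl → bad⇒≁S st bad-u s∈S (symmetric G sx) })
                              (λ { refl → bad⇒≁S st bad-v s∈S (symmetric G sx) })
      in p , q , sp , sq , λ eq → ≢ (trans (sym (kept sp)) (trans eq (kept sq)))
    ... | inj₂ s∈v with refl ← x∈⁅y⁆⇒x≡y v s∈v =
      let z , vz , z≢u = another G (proj₁ bad-v) u
          u≢v = λ u≡v → loopless G u≡v uv
          z≢v = λ z≡v → loopless G (sym z≡v) vz
          cu : c″ u ≡ inj₁ d
          cu = trans (recolour-other c′ v _ u≢v) (recolour-same (c st) u _)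
          cz : c″ z ≡ inj₁ a
          cz = trans (unchanged z≢u z≢v) (trans (mono st bad-v vz (symmetric G uv)) cu≡a)
      in u , z , symmetric G uv , vz , λ eq → d≢a (inj₁-injective (trans (sym cu) (trans eq cz)))

  -- If the bad vertices are independent, some neighbour of each of them gets
  -- the spare colour named after the bad vertex. All other spare colours are
  -- those of S, and no vertex of S is adjacent to a bad vertex.
  finish : ∀ {S} (st : Starred S) → (∀ {u v} → Bad st u → Bad st v → ¬ Adj G u v) →
           ∃[ T ] Independent G T × DynamicallyColourable G (3 + m + ∣ T ∣)
  finish {S} st no-bad-edge = T , independent-T , dynamicallyColourable G T c′ named proper′ two′
    where
    T? : U.Decidable (λ v → v ∈ S ⊎ Bad st v)
    T? v = (v ∈? S) ⊎-dec bad? st v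

    T = subset T?

    independent-T : Independent G T
    independent-T u v u∈T v∈T uv with ∈-subset⁻ T? u∈T | ∈-subset⁻ T? v∈T
    ... | inj₁ u∈S   | inj₁ v∈S   = independent st u v u∈S v∈S uv
    ... | inj₁ u∈S   | inj₂ bad-v = bad⇒≁S st bad-v u∈S (symmetric G uv)
    ... | inj₂ bad-u | inj₁ v∈S   = bad⇒≁S st bad-u v∈S uv
    ... | inj₂ bad-u | inj₂ bad-v = no-bad-edge bad-u bad-v uv

    chosen : Fin n → Fin n
    chosen v with any? (adj? G v)
    ... | yes (u , _) = u
    ... | no  _       = v

    chosen-adj : ∀ {v} → Bad st v → Adj G v (chosen v)
    chosen-adj {v} bad with any? (adj? G v)
    ... | yes (_ , vu) = vu
    ... | no  none     = contradiction (neighbour G (ℕ.≤-trans (s≤s z≤n) (proj₁ bad))) none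

    chooser? : ∀ x → Dec (∃[ w ] Bad st w × chosen w ≡ x)
    chooser? x = any? λ w → bad? st w ×-dec (chosen w ≟ x)

    c′ : Fin n → Colour
    c′ x with chooser? x
    ... | yes (w , _) = inj₂ w
    ... | no  _       = c st x

    -- Since the recoloured vertices have colours that appear nowhere else, the
    -- new colouring separates all pairs that the old one separates.
    refines : ∀ {x y} → c′ x ≡ c′ y → x ≡ y ⊎ c st x ≡ c st y
    refines {x} {y} eq with chooser? x | chooser? y
    ... | yes (w , _ , refl) | yes (w′ , _ , refl) = inj₁ (cong chosen (inj₂-injective eq))
    ... | yes (w , bad , _)  | no _ = contradiction (proj₂ (star⇒ st (sym eq))) (bad⇒∉S st bad)
    ... | no _ | yes (w , bad , _)  = contradiction (proj₂ (star⇒ st eq)) (bad⇒∉S st bad)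
    ... | no _ | no _ = inj₂ eq

    named : ∀ {v s} → c′ v ≡ inj₂ s → s ∈ T
    named {v} eq with chooser? v
    ... | yes (w , bad , _) with refl ← eq = ∈-subset⁺ T? (inj₂ bad)
    ... | no _ = ∈-subset⁺ T? (inj₁ (proj₂ (star⇒ st eq)))

    proper′ : ∀ u v → Adj G u v → c′ u ≢ c′ v
    proper′ u v uv eq with refines eq
    ... | inj₁ u≡v = loopless G u≡v uv
    ... | inj₂ same = proper st u v uv same

    chosen-unique : ∀ {w q} → Bad st w → c′ (chosen w) ≡ c′ q → q ≡ chosen w
    chosen-unique {w} {q} bad eq with chooser? (chosen w) | chooser? q
    ... | no none | _ = contradiction (w , bad , refl) none
    ... | yes (w₁ , _ , eq₁) | yes (w₂ , _ , eq₂) =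
      trans (sym eq₂) (trans (cong chosen (inj₂-injective (sym eq))) eq₁)
    ... | yes (w₁ , bad₁ , _) | no _ = contradiction (proj₂ (star⇒ st (sym eq))) (bad⇒∉S st bad₁)

    two′ : ∀ v → 2 ≤ degree G v → TwoColoured G c′ v
    two′ v 2≤ with twoColoured? G _≟ᶜ_ (c st) v
    ... | yes (u , w , vu , vw , ≢) = u , w , vu , vw , λ eq →
      [ (λ { refl → ≢ refl }) , ≢ ]′ (refines eq)
    ... | no ¬two =
      let q , vq , q≢ = another G 2≤ (chosen v)
      in chosen v , q , chosen-adj (2≤ , ¬two) , vq , λ eq → q≢ (chosen-unique (2≤ , ¬two) eq)

  star-all : ∀ {S} → Acc _⊃_ S → Starred S → ∃[ T ] Independent G T × DynamicallyColourable G (3 + m + ∣ T ∣)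
  star-all {S} (acc rec) st with any? (λ u → any? λ v → bad? st u ×-dec bad? st v ×-dec adj? G u v)
  ... | no  none = finish st λ bad-u bad-v uv → none (_ , _ , bad-u , bad-v , uv)
  ... | yes (u , v , bad-u , bad-v , uv) = star-all
    (rec ((λ x∈S → x∈p∪q⁺ (inj₁ x∈S)) , v , x∈p∪q⁺ (inj₂ (x∈⁅x⁆ v)) , bad⇒∉S st bad-v))
    (add-star st bad-u bad-v uv)

  independence-bound : Colourable G (3 + m) → ∃[ T ] Independent G T × DynamicallyColourable G (3 + m + ∣ T ∣)
  independence-bound (c , proper) = star-all (⊃-wellFounded ⊥) record
    { c           = inj₁ ∘ c
    ; proper      = λ u v uv eq → proper u v uv (inj₁-injective eq)
    ; starred     = λ s∈⊥ → contradiction s∈⊥ ∉⊥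
    ; star⇒       = λ ()
    ; independent = λ _ _ u∈⊥ → contradiction u∈⊥ ∉⊥
    ; twoColoured = λ s∈⊥ → contradiction s∈⊥ ∉⊥
    }

-- Chromatic number at least 3 is enough here.
χ₂≤χ+α : ∀ {n} (G : Graph n) → 3 ≤ χ G → χ₂ G ≤ χ G + α G
χ₂≤χ+α G 3≤ with χ G | χ-colouring G | 3≤
... | suc (suc (suc m)) | col | s≤s (s≤s (s≤s z≤n)) =
  let T , ind , dyn = independence-bound G col
  in ℕ.≤-trans (χ₂≤ G dyn) (ℕ.+-monoʳ-≤ (3 + m) (∣∣≤α G ind))

------------------------------------------------------------------------
-- Monochromatic neighbourhoods in regular graphs

-- A maximal sublist without conflicts, for a symmetric conflict relation R.
maximal : {A : Set} {R : A → A → Set} → B.Decidable R → B.Symmetric R → (xs : List A) →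
          ∃[ ys ] (∀ {y} → y List.∈ ys → y List.∈ xs) ×
                  (∀ {x y} → x List.∈ ys → y List.∈ ys → R x y → x ≡ y) ×
                  (∀ {x} → x List.∈ xs → R x x → ∃[ y ] y List.∈ ys × R x y)
maximal R? R-sym [] = [] , (λ ()) , (λ ()) , (λ ())
maximal {A} {R} R? R-sym (z ∷ xs) with maximal R? R-sym xs
... | ys , sub , apart , covers with Any.any? (R? z) ys
...   | yes hit = ys , there ∘ sub , apart , covers′
  where
  covers′ : ∀ {x} → x List.∈ z ∷ xs → R x x → ∃[ y ] y List.∈ ys × R x y
  covers′ (here refl) _   = List.find hit
  covers′ (there x∈)  Rxx = covers x∈ Rxx
...   | no miss = z ∷ ys , sub′ , apart′ , covers′
  where
  sub′ : ∀ {y} → y List.∈ z ∷ ys → y List.∈ z ∷ xs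
  sub′ (here refl) = here refl
  sub′ (there y∈)  = there (sub y∈)
  apart′ : ∀ {x y} → x List.∈ z ∷ ys → y List.∈ z ∷ ys → R x y → x ≡ y
  apart′ (here refl) (here refl) _ = refl
  apart′ (here refl) (there y∈)  r = contradiction (List.lose y∈ r) miss
  apart′ (there x∈)  (here refl) r = contradiction (List.lose x∈ (R-sym r)) miss
  apart′ (there x∈)  (there y∈)  r = apart x∈ y∈ r
  covers′ : ∀ {x} → x List.∈ z ∷ xs → R x x → ∃[ y ] y List.∈ z ∷ ys × R x y
  covers′ (here refl) Rxx = z , here refl , Rxx
  covers′ (there x∈)  Rxx = let y , y∈ , r = covers x∈ Rxx in y , there y∈ , r

module _ {n L : ℕ} (G : Graph n) where

  -- All neighbours of v have colour a.
  Mono : (Fin n → Fin L) → Fin n → Fin L → Set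
  Mono c v a = ∀ u → Adj G v u → c u ≡ a

  mono? : ∀ c v a → Dec (Mono c v a)
  mono? c v a = all? λ u → adj? G v u →-dec (c u ≟ a)

  ¬mono⇒ : ∀ {c v a} → ¬ Mono c v a → ∃[ u ] Adj G v u × c u ≢ a
  ¬mono⇒ {c} {v} {a} ¬mono with any? (λ u → adj? G v u ×-dec ¬? (c u ≟ a))
  ... | yes found = found
  ... | no  none  = contradiction (λ u vu → decidable-stable (c u ≟ a) λ ≢ → none (u , vu , ≢)) ¬mono

module _ {n k : ℕ} (G : Graph n) (reg : Regular G (suc (suc k))) where

  regular⇒2≤degree : ∀ v → 2 ≤ degree G v
  regular⇒2≤degree v = subst (2 ≤_) (sym (reg v)) (s≤s (s≤s z≤n))

  regular⇒neighbour : ∀ v → ∃[ u ] Adj G v u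
  regular⇒neighbour v = neighbour G (ℕ.≤-trans (s≤s z≤n) (regular⇒2≤degree v))

-- A proper colouring in which every vertex of non-zero colour has a neighbour
-- of colour 0.
record Base {n m : ℕ} (G : Graph n) (c : Fin n → Fin (suc m)) : Set where
  field
    proper     : Proper G c
    dominating : ∀ {v} → c v ≢ 0F → ∃[ u ] Adj G v u × c u ≡ 0F

  mono-0 : ∀ {v u} → Mono G c v 0F → Adj G v u → c v ≢ 0F
  mono-0 {v} {u} mono vu cv≡0 = proper v u vu (trans cv≡0 (sym (mono u vu)))

  mono-≢0 : ∀ {v a} → Mono G c v a → a ≢ 0F → c v ≡ 0F
  mono-≢0 {v} mono a≢0 = decidable-stable (c v ≟ 0F) λ cv≢0 →
    let u , vu , cu≡0 = dominating cv≢0 in a≢0 (trans (sym (mono u vu)) cu≡0)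

-- Let c satisfy Base, for a regular graph of degree at least 2. Spare colours
-- make it dynamic, one for each colour a that is the only colour on the
-- neighbourhood of some vertex; the name of the spare colour is star a. The
-- colour r must not occur on the vertices whose neighbours all have colour 0.
module Refine {n m k : ℕ} (G : Graph n) (reg : Regular G (suc (suc k)))
  (c : Fin n → Fin (suc m)) (base : Base G c)
  (r : Fin (suc m)) (r≢0 : r ≢ 0F) (r-free : ∀ {w} → Mono G c w 0F → c w ≢ r)
  (S : Subset n) (star : Fin (suc m) → Fin n)
  (star∈ : ∀ {v a} → Mono G c v a → star a ∈ S)
  (star-injective : ∀ {u v a b} → Mono G c u a → Mono G c v b → star a ≡ star b → a ≡ b)
  where

  open Base base

  private
    -- The vertices whose neighbours all have colour 0.
    W : Fin n → Set
    W v = Mono G c v 0F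

    2≤deg : ∀ v → 2 ≤ degree G v
    2≤deg = regular⇒2≤degree G reg

    some : ∀ v → ∃[ u ] Adj G v u
    some = regular⇒neighbour G reg

    W⇒≢0 : ∀ {v} → W v → c v ≢ 0F
    W⇒≢0 {v} Wv = mono-0 Wv (proj₂ (some v))

    -- All vertices at the end of a walk of length two from y are in W.
    Deep : Fin n → Set
    Deep y = ∀ x → Adj G y x → ∀ w → Adj G x w → W w

    deep? : U.Decidable Deep
    deep? y = all? λ x → adj? G y x →-dec all? λ w → adj? G x w →-dec mono? G c w 0F

    ¬deep⇒ : ∀ {y} → ¬ Deep y → ∃[ x ] ∃[ w ] Adj G y x × Adj G x w × ¬ W w
    ¬deep⇒ {y} ¬deep with any? (λ x → any? λ w → adj? G y x ×-dec adj? G x w ×-dec ¬? (mono? G c w 0F))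
    ... | yes found = found
    ... | no  none  = contradiction (λ x yx w xw → decidable-stable (mono? G c w 0F)
                        λ ¬Ww → none (x , w , yx , xw , ¬Ww)) ¬deep

    -- If one side of a bipartite component of G is coloured 0, then the other side
    -- lies in W, and all vertices of the component may have monochromatic
    -- neighbourhoods, so that splitting does not apply to them. Hence a few
    -- adjacent pairs (y , x) with y deep are exempted, namely a maximal family
    -- such that for different pairs neither the first components nor the second
    -- components have a common neighbour.
    Pair : Set
    Pair = Fin n × Fin n

    Candidate : Pair → Set
    Candidate (y , x) = Deep y × Adj G y x

    Conflict : Pair → Pair → Set
    Conflict (y , x) (y′ , x′) =
      (∃[ v ] Adj G y v × Adj G y′ v) ⊎ (∃[ v ] Adj G x v × Adj G x′ v)

    candidate? : U.Decidable Candidate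
    candidate? (y , x) = deep? y ×-dec adj? G y x

    conflict? : B.Decidable Conflict
    conflict? (y , x) (y′ , x′) =
      any? (λ v → adj? G y v ×-dec adj? G y′ v) ⊎-dec any? (λ v → adj? G x v ×-dec adj? G x′ v)

    conflict-sym : B.Symmetric Conflict
    conflict-sym (inj₁ (v , p , q)) = inj₁ (v , q , p)
    conflict-sym (inj₂ (v , p , q)) = inj₂ (v , q , p)

    candidates : List Pair
    candidates = filter candidate? (cartesianProduct (allFin n) (allFin n))

    packing = maximal conflict? conflict-sym candidates

    pairs : List Pair
    pairs = proj₁ packing

    _∈ᵖ_ : Pair → List Pair → Set
    _∈ᵖ_ = List._∈_

    candidate : ∀ {p} → p ∈ᵖ pairs → Candidate p
    candidate p∈ = proj₂ (∈-filter⁻ candidate?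
      {xs = cartesianProduct (allFin n) (allFin n)} (proj₁ (proj₂ packing) p∈))

    conflict⇒≡ : ∀ {p q} → p ∈ᵖ pairs → q ∈ᵖ pairs → Conflict p q → p ≡ q
    conflict⇒≡ = proj₁ (proj₂ (proj₂ packing))

    covered : ∀ {y x} → Deep y → Adj G y x → ∃[ p ] p ∈ᵖ pairs × Conflict (y , x) p
    covered {y} {x} deep yx = proj₂ (proj₂ (proj₂ packing))
      (∈-filter⁺ candidate? (∈-cartesianProduct⁺ (∈-allFin y) (∈-allFin x)) (deep , yx))
      (inj₁ (x , yx , yx))

    -- The first and the second components of the chosen pairs.
    Root Tip : Fin n → Set
    Root y = ∃[ x ] (y , x) ∈ᵖ pairs
    Tip  x = ∃[ y ] (y , x) ∈ᵖ pairs

    open DecList (Product.≡-dec (_≟_ {n}) (_≟_ {n})) using () renaming (_∈?_ to _∈ᵖ?_)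

    root? : U.Decidable Root
    root? y = any? λ x → (y , x) ∈ᵖ? pairs

    tip? : U.Decidable Tip
    tip? x = any? λ y → (y , x) ∈ᵖ? pairs

    module _ {y x : Fin n} (p∈ : (y , x) ∈ᵖ pairs) where

      root~tip : Adj G y x
      root~tip = proj₂ (candidate p∈)

      near-root : ∀ {v w} → Adj G y v → Adj G v w → W w
      near-root yv vw = proj₁ (candidate p∈) _ yv _ vw

      root-W : W y
      root-W = near-root root~tip (symmetric G root~tip)

      tip-0 : c x ≡ 0F
      tip-0 = root-W x root~tip

      tip-W : ∀ {w} → Adj G x w → W w
      tip-W = near-root root~tip

    toSplit? : U.Decidable (λ v → (∃[ a ] Mono G c v a) × ¬ Root v × ¬ Tip v)
    toSplit? v = any? (mono? G c v) ×-dec ¬? (root? v) ×-dec ¬? (tip? v)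

    -- The vertices whose neighbourhood the labelling is to split.
    toSplit : Subset n
    toSplit = subset toSplit?

    root∉ : ∀ {y x} → (y , x) ∈ᵖ pairs → y ∉ toSplit
    root∉ p∈ y∈ = proj₁ (proj₂ (∈-subset⁻ toSplit? y∈)) (_ , p∈)

    tip∉ : ∀ {y x} → (y , x) ∈ᵖ pairs → x ∉ toSplit
    tip∉ p∈ x∈ = proj₂ (proj₂ (∈-subset⁻ toSplit? x∈)) (_ , p∈)

    good∉ : ∀ {v} → c v ≢ 0F → ¬ W v → v ∉ toSplit
    good∉ {v} cv≢0 ¬Wv v∈ =
      let (a , mono) , _ = ∈-subset⁻ toSplit? v∈
          a≡0 = decidable-stable (a ≟ 0F) (cv≢0 ∘ mono-≢0 mono)
      in ¬Wv (subst (Mono G c v) a≡0 mono)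

    -- For v with deep vertices nearby, maximality of the family provides a root
    -- or a tip at the end of a walk of length three; otherwise the
    -- walk ends at some vertex of non-zero colour outside W.
    escapes : Escapes G toSplit
    escapes v with mono? G c v 0F
    escapes v | yes Wv with deep? v
    ... | yes deep = let x , vx = some v in via vx (covered deep vx)
      where
      via : ∀ {x} → Adj G v x → ∃[ p ] p ∈ᵖ pairs × Conflict (v , x) p → _
      via vx ((y′ , x′) , p∈ , inj₁ (u , vu , y′u)) =
        u , y′ , x′ , vu , symmetric G y′u , root~tip p∈ , tip∉ p∈
      via vx ((y′ , x′) , p∈ , inj₂ (u , xu , x′u)) =
        _ , u , x′ , vx , xu , symmetric G x′u , tip∉ p∈
    ... | no ¬deep =
      let x , w , vx , xw , ¬Ww = ¬deep⇒ ¬deep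
          w′ , ww′ , cw′≢0 = ¬mono⇒ G ¬Ww
          cw≢0 = λ cw≡0 → proper x w xw (trans (Wv x vx) (sym cw≡0))
      in x , w , w′ , vx , xw , ww′ , good∉ cw′≢0 (λ Ww′ → cw≢0 (Ww′ w (symmetric G ww′)))
    escapes v | no ¬Wv with c v ≟ 0F
    ... | no cv≢0 =
      let u , vu , cu≢0 = ¬mono⇒ G ¬Wv
      in u , v , u , vu , symmetric G vu , vu , good∉ cu≢0 (λ Wu → cv≢0 (Wu v (symmetric G vu)))
    ... | yes cv≡0 with some v
    ...   | w , vw with mono? G c w 0F
    ...     | no ¬Ww = w , v , w , vw , symmetric G vw , vw ,
                good∉ (λ cw≡0 → proper v w vw (trans cv≡0 (sym cw≡0))) ¬Ww
    ...     | yes Ww with deep? w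
    ...       | no ¬deep =
                let x , w′ , wx , xw′ , ¬Ww′ = ¬deep⇒ ¬deep
                in w , x , w′ , vw , wx , xw′ ,
                   good∉ (λ cw′≡0 → proper x w′ xw′ (trans (Ww x wx) (sym cw′≡0))) ¬Ww′
    ...       | yes deep = via (covered deep (symmetric G vw))
      where
      via : ∃[ p ] p ∈ᵖ pairs × Conflict (w , v) p → _
      via ((y′ , x′) , p∈ , inj₁ (u , wu , y′u)) =
        w , u , y′ , vw , wu , symmetric G y′u , root∉ p∈
      via ((y′ , x′) , p∈ , inj₂ (u , vu , x′u)) =
        u , x′ , y′ , vu , symmetric G x′u , symmetric G (root~tip p∈) , root∉ p∈

    split = splitting G reg escapes

    -- The labels.
    s : Fin n → Bool
    s = proj₁ split

    -- The colour a refined by a label: when some neighbourhood has a as its only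
    -- colour, the label true stands for the spare colour, and otherwise labels
    -- are ignored.
    σ : Fin (suc m) → Bool → Fin (suc m) ⊎ Fin n
    σ a false = inj₁ a
    σ a true with any? (λ v → mono? G c v a)
    ... | yes _ = inj₂ (star a)
    ... | no  _ = inj₁ a

    σ-injective : ∀ a β b γ → σ a β ≡ σ b γ → a ≡ b
    σ-injective a false b false eq = inj₁-injective eq
    σ-injective a false b true  eq with any? (λ v → mono? G c v b)
    ... | yes _ with () ← eq
    ... | no  _ = inj₁-injective eq
    σ-injective a true  b false eq with any? (λ v → mono? G c v a)
    ... | yes _ with () ← eq
    ... | no  _ = inj₁-injective eq
    σ-injective a true  b true  eq with any? (λ v → mono? G c v a) | any? (λ v → mono? G c v b)
    ... | yes (_ , mono) | yes (_ , mono′) = star-injective mono mono′ (inj₂-injective eq)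
    ... | no _ | no _ = inj₁-injective eq
    ... | yes _ | no _ with () ← eq
    ... | no _ | yes _ with () ← eq

    σ-true : ∀ {v a} → Mono G c v a → σ a true ≡ inj₂ (star a)
    σ-true {v} {a} mono with any? (λ v → mono? G c v a)
    ... | yes _    = refl
    ... | no  none = contradiction (v , mono) none

    σ-splits : ∀ {v a} → Mono G c v a → ∀ β γ → σ a β ≡ σ a γ → β ≡ γ
    σ-splits mono false false eq = refl
    σ-splits mono true  true  eq = refl
    σ-splits mono false true  eq with () ← trans eq (σ-true mono)
    σ-splits mono true  false eq with () ← trans (sym (σ-true mono)) eq

    σ-named : ∀ a β {v} → σ a β ≡ inj₂ v → v ∈ S
    σ-named a true eq with any? (λ v → mono? G c v a)
    ... | yes (_ , mono) with refl ← eq = star∈ mono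

    -- The labelling does not split the neighbourhood of y, for x adjacent to y.
    Tied : Fin n → Fin n → Set
    Tied y x = ∀ u → Adj G y u → s u ≡ s x

    tied? : ∀ y x → Dec (Tied y x)
    tied? y x = all? λ u → adj? G y u →-dec (s u Bool.≟ s x)

    -- The final colouring refines c by the labels, except at the chosen pairs
    -- (y , x). If the neighbourhood of y is split, y gets the colour r, so that
    -- the neighbours of y see r at y and other colours at their other neighbours,
    -- which are in W. If it is not split, then x gets the colour r, and y can get
    -- that refinement of 0 which does not occur on its neighbours.
    data Role (v : Fin n) : Set where
      plain     : ¬ Root v → ¬ (∃[ y ] (y , v) ∈ᵖ pairs × Tied y v) → Role v
      tiedRoot  : ∀ x → (v , x) ∈ᵖ pairs → Tied v x → Role v
      splitRoot : ∀ x → (v , x) ∈ᵖ pairs → ¬ Tied v x → Role v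
      tiedTip   : ∀ y → (y , v) ∈ᵖ pairs → Tied y v → Role v

    role : ∀ v → Role v
    role v with root? v | any? (λ y → ((y , v) ∈ᵖ? pairs) ×-dec tied? y v)
    ... | no ¬root       | no ¬tip             = plain ¬root ¬tip
    ... | no _           | yes (y , p∈ , tied) = tiedTip y p∈ tied
    ... | yes (x , p∈)   | _ with tied? v x
    ...   | yes tied  = tiedRoot x p∈ tied
    ...   | no  ¬tied = splitRoot x p∈ ¬tied

    paint : ∀ {v} → Role v → Fin (suc m) ⊎ Fin n
    paint {v} (plain _ _)         = σ (c v) (s v)
    paint     (tiedRoot x _ _)    = σ 0F (not (s x))
    paint     (splitRoot _ _ _)   = σ r false
    paint     (tiedTip _ _ _)     = σ r false

    colour : Fin n → Fin (suc m) ⊎ Fin n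
    colour v = paint (role v)

    named : ∀ {v t} (ρ : Role v) → paint ρ ≡ inj₂ t → t ∈ S
    named {v} (plain _ _)   = σ-named (c v) (s v)
    named (tiedRoot x _ _)  = σ-named 0F (not (s x))
    named (splitRoot _ _ _) = σ-named r false
    named (tiedTip _ _ _)   = σ-named r false

    -- The neighbours of a root have colour 0 in c.
    root-proper : ∀ {u v} → Adj G u v → Root u → (ρ : Role u) (ρ′ : Role v) → paint ρ ≢ paint ρ′
    root-proper uv (_ , p∈) _ (tiedRoot _ q∈ _)  = contradiction (root-W p∈ _ uv) (W⇒≢0 (root-W q∈))
    root-proper uv (_ , p∈) _ (splitRoot _ q∈ _) = contradiction (root-W p∈ _ uv) (W⇒≢0 (root-W q∈))
    root-proper uv root (plain ¬root _) _ = contradiction root ¬root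
    root-proper uv (_ , p∈) (tiedTip _ q∈ _) _ = contradiction (tip-0 q∈) (W⇒≢0 (root-W p∈))
    root-proper uv _ (tiedRoot x p∈ tied) (plain _ _) eq
      rewrite root-W p∈ _ uv = not-¬ (tied _ uv) (sym (σ-splits (root-W p∈) _ _ eq))
    root-proper {v = v} uv _ (splitRoot x p∈ _) (plain _ _) eq
      rewrite root-W p∈ _ uv = r≢0 (σ-injective r false 0F (s v) eq)
    root-proper uv _ (tiedRoot x p∈ _) (tiedTip _ _ _) eq = r≢0 (sym (σ-injective 0F (not (s x)) r false eq))
    root-proper uv _ (splitRoot x p∈ ¬tied) (tiedTip _ q∈ tied) eq
      with refl ← conflict⇒≡ p∈ q∈ (inj₁ (_ , uv , root~tip q∈)) = ¬tied tied

    role-proper : ∀ {u v} → Adj G u v → (ρ : Role u) (ρ′ : Role v) → paint ρ ≢ paint ρ′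
    role-proper uv ρ@(tiedRoot x p∈ _)  ρ′ = root-proper uv (x , p∈) ρ ρ′
    role-proper uv ρ@(splitRoot x p∈ _) ρ′ = root-proper uv (x , p∈) ρ ρ′
    role-proper uv ρ ρ′@(tiedRoot x p∈ _)  = root-proper (symmetric G uv) (x , p∈) ρ′ ρ ∘ sym
    role-proper uv ρ ρ′@(splitRoot x p∈ _) = root-proper (symmetric G uv) (x , p∈) ρ′ ρ ∘ sym
    role-proper {u} {v} uv (plain _ _) (plain _ _) eq =
      proper u v uv (σ-injective (c u) (s u) (c v) (s v) eq)
    role-proper {u} uv (plain _ _) (tiedTip _ p∈ _) eq =
      r-free (tip-W p∈ (symmetric G uv)) (σ-injective (c u) (s u) r false eq)
    role-proper {v = v} uv (tiedTip _ p∈ _) (plain _ _) eq =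
      r-free (tip-W p∈ uv) (sym (σ-injective r false (c v) (s v) eq))
    role-proper uv (tiedTip _ p∈ _) (tiedTip _ q∈ _) = contradiction (tip-0 q∈) (W⇒≢0 (tip-W p∈ uv))

    -- The neighbours of a neighbour v of a root y are in W, and y is the only
    -- root among them.
    root-two : ∀ {v y x q} → Adj G v y → (y , x) ∈ᵖ pairs → Adj G v q → q ≢ y →
               (ρ : Role y) (ρ′ : Role q) → paint ρ ≢ paint ρ′
    root-two vy p∈ vq q≢y (plain ¬root _) _ = contradiction (_ , p∈) ¬root
    root-two vy p∈ vq q≢y (tiedTip _ q∈ _) _ = contradiction (tip-0 q∈) (W⇒≢0 (root-W p∈))
    root-two vy p∈ vq q≢y _ (tiedRoot _ q∈ _) =
      contradiction (cong proj₁ (conflict⇒≡ q∈ p∈ (inj₁ (_ , symmetric G vq , symmetric G vy)))) q≢y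
    root-two vy p∈ vq q≢y _ (splitRoot _ q∈ _) =
      contradiction (cong proj₁ (conflict⇒≡ q∈ p∈ (inj₁ (_ , symmetric G vq , symmetric G vy)))) q≢y
    root-two vy p∈ vq q≢y _ (tiedTip _ q∈ _) =
      contradiction (tip-0 q∈) (W⇒≢0 (near-root p∈ (symmetric G vy) vq))
    root-two {q = q} vy p∈ vq q≢y (tiedRoot x _ _) (plain _ _) eq =
      W⇒≢0 (near-root p∈ (symmetric G vy) vq) (sym (σ-injective 0F (not (s x)) (c q) (s q) eq))
    root-two {q = q} vy p∈ vq q≢y (splitRoot _ _ _) (plain _ _) eq =
      r-free (near-root p∈ (symmetric G vy) vq) (sym (σ-injective r false (c q) (s q) eq))

    -- The neighbours of a neighbour v of a tip x have colour 0 in c, and x is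
    -- the only tip among them.
    tip-two : ∀ {v y x q} → Adj G v x → (y , x) ∈ᵖ pairs → Tied y x → Adj G v q → q ≢ x →
              (ρ : Role x) (ρ′ : Role q) → paint ρ ≢ paint ρ′
    tip-two vx p∈ tied vq q≢x (plain _ ¬tip) _ = contradiction (_ , p∈ , tied) ¬tip
    tip-two vx p∈ tied vq q≢x (tiedRoot _ q∈ _) _ = contradiction (tip-0 p∈) (W⇒≢0 (root-W q∈))
    tip-two vx p∈ tied vq q≢x (splitRoot _ q∈ _) _ = contradiction (tip-0 p∈) (W⇒≢0 (root-W q∈))
    tip-two vx p∈ tied vq q≢x _ (tiedRoot _ q∈ _) =
      contradiction (tip-W p∈ (symmetric G vx) _ vq) (W⇒≢0 (root-W q∈))
    tip-two vx p∈ tied vq q≢x _ (splitRoot _ q∈ _) =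
      contradiction (tip-W p∈ (symmetric G vx) _ vq) (W⇒≢0 (root-W q∈))
    tip-two vx p∈ tied vq q≢x _ (tiedTip _ q∈ _) =
      contradiction (cong proj₂ (conflict⇒≡ q∈ p∈ (inj₂ (_ , symmetric G vq , symmetric G vx)))) q≢x
    tip-two {q = q} vx p∈ tied vq q≢x (tiedTip _ _ _) (plain _ _) eq =
      r≢0 (trans (σ-injective r false (c q) (s q) eq) (tip-W p∈ (symmetric G vx) q vq))

    RootNear TipNear : Fin n → Set
    RootNear v = ∃[ y ] Adj G v y × Root y
    TipNear  v = ∃[ x ] Adj G v x × ∃[ y ] (y , x) ∈ᵖ pairs × Tied y x

    module _ {v : Fin n} (no-root : ¬ RootNear v) (no-tip : ¬ TipNear v) where

      plain-colour : ∀ {u} → Adj G v u → colour u ≡ σ (c u) (s u)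
      plain-colour {u} vu with role u
      ... | plain _ _          = refl
      ... | tiedRoot x p∈ _    = contradiction (u , vu , x , p∈) no-root
      ... | splitRoot x p∈ _   = contradiction (u , vu , x , p∈) no-root
      ... | tiedTip y p∈ tied  = contradiction (u , vu , y , p∈ , tied) no-tip

      split-two : ∀ {a u w} → Mono G c v a → Adj G v u → Adj G v w → s u ≢ s w → TwoColoured G colour v
      split-two {a} {u} {w} mono vu vw ≢ = u , w , vu , vw , λ eq → ≢ (σ-splits mono (s u) (s w)
        (trans (sym (colour-σ vu)) (trans eq (colour-σ vw))))
        where
        colour-σ : ∀ {u} → Adj G v u → colour u ≡ σ a (s u)
        colour-σ {u} vu = trans (plain-colour vu) (cong (λ b → σ b (s u)) (mono u vu))

      plain-two : TwoColoured G colour v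
      plain-two with any? (mono? G c v)
      ... | no none =
        let u , vu = some v
            w , vw , cw≢cu = ¬mono⇒ G (λ mono → none (c u , mono))
        in u , w , vu , vw , λ eq → cw≢cu (sym (σ-injective (c u) (s u) (c w) (s w)
             (trans (sym (plain-colour vu)) (trans eq (plain-colour vw)))))
      ... | yes (a , mono) with root? v | tip? v
      ...   | _ | yes (y , p∈) = contradiction (y , symmetric G (root~tip p∈) , v , p∈) no-root
      ...   | no ¬root | no ¬tip =
        let x , w , vx , vw , ≢ = proj₂ split (∈-subset⁺ toSplit? ((a , mono) , ¬root , ¬tip))
        in split-two mono vx vw ≢
      ...   | yes (x , p∈) | no _ with any? (λ u → adj? G v u ×-dec ¬? (s u Bool.≟ s x))
      ...     | yes (u , vu , ≢) = split-two mono vu (root~tip p∈) ≢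
      ...     | no all-tied = contradiction
                (x , root~tip p∈ , v , p∈ , λ u vu → decidable-stable (s u Bool.≟ s x) λ ≢ → all-tied (u , vu , ≢))
                no-tip

    two-coloured : ∀ v → TwoColoured G colour v
    two-coloured v with any? (λ y → adj? G v y ×-dec root? y)
    ... | yes (y , vy , _ , p∈) =
      let q , vq , q≢y = another G (2≤deg v) y
      in y , q , vy , vq , root-two vy p∈ vq q≢y (role y) (role q)
    ... | no no-root with any? (λ x → adj? G v x ×-dec any? λ y → ((y , x) ∈ᵖ? pairs) ×-dec tied? y x)
    ...   | yes (x , vx , y , p∈ , tied) =
      let q , vq , q≢x = another G (2≤deg v) x
      in x , q , vx , vq , tip-two vx p∈ tied vq q≢x (role x) (role q)
    ...   | no no-tip = plain-two no-root no-tip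

  refined : DynamicallyColourable G (suc m + ∣ S ∣)
  refined = dynamicallyColourable G S colour (λ {v} → named (role v))
    (λ u v uv → role-proper uv (role u) (role v)) (λ v _ → two-coloured v)

------------------------------------------------------------------------
-- Independent sets of names in the square

module _ {n m : ℕ} (G : Graph n) where

  private
    -- The condition of Base at a single vertex.
    Dominated : (Fin n → Fin (suc m)) → Fin n → Set
    Dominated c v = c v ≢ 0F → ∃[ u ] Adj G v u × c u ≡ 0F

    -- A vertex without neighbours of colour 0 can itself get the colour 0, and
    -- this does not hurt vertices treated before.
    dominate : (xs : List (Fin n)) → Colourable G (suc m) →
               ∃[ c ] Proper G c × ∀ {v} → v List.∈ xs → Dominated c v
    dominate []       (c , proper) = c , proper , λ ()
    dominate (x ∷ xs) col with dominate xs col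
    ... | c , proper , dom with any? (λ u → adj? G x u ×-dec (c u ≟ 0F))
    ...   | yes near = c , proper , λ { (here refl) _ → near ; (there v∈) → dom v∈ }
    ...   | no  free = c′ , recolour-proper G proper x (λ u xu cu≡0 → free (u , xu , cu≡0)) , dom′
      where
      c′ : Fin n → Fin (suc m)
      c′ = recolour c x 0F
      still : ∀ {u} → c u ≡ 0F → c′ u ≡ 0F
      still {u} eq with u ≟ x
      ... | yes _ = refl
      ... | no  _ = eq
      dom′ : ∀ {v} → v List.∈ x ∷ xs → Dominated c′ v
      dom′ (here refl) ≢0 = contradiction (recolour-same c x 0F) ≢0
      dom′ (there v∈)  ≢0 = let u , vu , cu≡0 = dom v∈ (≢0 ∘ still) in u , vu , still cu≡0

  base-colouring : Colourable G (suc m) → ∃[ c ] Base G c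
  base-colouring col =
    let c , proper , dom = dominate (allFin n) col
    in c , record { proper = proper ; dominating = λ {v} → dom (∈-allFin v) }

module _ {n : ℕ} (G : Graph n) where

  within-two : ∀ {u v} → Dist≤ G u v 2 → u ≡ v ⊎ Adj G u v ⊎ (∃[ x ] Adj G u x × Adj G v x)
  within-two (_ , ([] , _) , _)                   = inj₁ refl
  within-two (_ , (a ∷ [] , _) , _)               = inj₂ (inj₁ a)
  within-two (_ , (a ∷ b ∷ [] , _) , _)           = inj₂ (inj₂ (_ , a , symmetric G b))
  within-two (_ , (_ ∷ _ ∷ _ ∷ _ , _) , s≤s (s≤s ()))

-- A regular graph of degree at least 2, with at least four colours. Write W for
-- the set of vertices whose neighbours all have colour 0.
module Choose {n m k : ℕ} (G : Graph n) (reg : Regular G (suc (suc k))) where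

  private
    L : ℕ
    L = 4 + m

    2≤deg : ∀ v → 2 ≤ degree G v
    2≤deg = regular⇒2≤degree G reg

    some : ∀ v → ∃[ u ] Adj G v u
    some = regular⇒neighbour G reg

    -- Spare colours named after the elements of a set S that is independent in
    -- the square of G.
    Goal : Set
    Goal = ∃[ S ] Independent (square G) S × DynamicallyColourable G (L + ∣ S ∣)

  -- If all neighbours of u have colour a and all neighbours of v have another
  -- colour b, then u and v have no common neighbour. So it suffices to choose
  -- one such vertex for each colour that occurs, pairwise non-adjacent. Those
  -- for non-zero colours all have colour 0. The vertex w is chosen for the
  -- colour 0; it can be adjacent to a vertex chosen for b only if c w = b, and
  -- w-free provides another choice then.
  module Spread (c : Fin n → Fin L) (base : Base G c)
    (r : Fin L) (r≢0 : r ≢ 0F) (r-free : ∀ {w} → Mono G c w 0F → c w ≢ r)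
    (w : Fin n) (w-mono : ∀ {v} → Mono G c v 0F → Mono G c w 0F)
    (w-free : Mono G c w 0F → ∀ {z} → Mono G c z (c w) → ∃[ z′ ] Mono G c z′ (c w) × ¬ Adj G w z′)
    where

    open Base base

    private
      apart? : ∀ a → Dec (∃[ z ] Mono G c z a × ¬ Adj G w z)
      apart? a = any? λ z → mono? G c z a ×-dec ¬? (adj? G w z)

      attained? : ∀ a → Dec (∃[ z ] Mono G c z a)
      attained? a = any? λ z → mono? G c z a

      -- The value w in the last case is a default.
      star : Fin L → Fin n
      star 0F = w
      star (suc a) with apart? (suc a) | attained? (suc a)
      ... | yes (z , _) | _           = z
      ... | no _        | yes (z , _) = z
      ... | no _        | no _        = w

      star-mono : ∀ {v} a → Mono G c v a → Mono G c (star a) a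
      star-mono 0F mono = w-mono mono
      star-mono (suc a) mono with apart? (suc a) | attained? (suc a)
      ... | yes (_ , mono′ , _) | _               = mono′
      ... | no _                | yes (_ , mono′) = mono′
      ... | no _                | no none         = contradiction (_ , mono) none

      star≁w : ∀ a → Mono G c w 0F → Mono G c (star (suc a)) (suc a) → ¬ Adj G w (star (suc a))
      star≁w a Ww mono adj with apart? (suc a) | attained? (suc a)
      ... | yes (_ , _ , ¬adj) | _ = ¬adj adj
      ... | no none | yes (z , _) =
        let cw≡ = mono w (symmetric G adj)
            z′ , mono′ , ¬adj = w-free Ww (subst (Mono G c z) (sym cw≡) mono)
        in none (z′ , subst (Mono G c z′) cw≡ mono′ , ¬adj)
      ... | no _ | no _ = loopless G refl adj

      star-apart : ∀ a b → Mono G c (star a) a → Mono G c (star b) b → ¬ Adj G (star a) (star b)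
      star-apart 0F 0F _ _ = loopless G refl
      star-apart 0F (suc b) mono-a mono-b = star≁w b mono-a mono-b
      star-apart (suc a) 0F mono-a mono-b = star≁w a mono-b mono-a ∘ symmetric G
      star-apart (suc a) (suc b) mono-a mono-b adj =
        proper _ _ adj (trans (mono-≢0 mono-a λ ()) (sym (mono-≢0 mono-b λ ())))

      used? : U.Decidable (λ v → ∃[ a ] Mono G c v a × star a ≡ v)
      used? v = any? λ a → mono? G c v a ×-dec (star a ≟ v)

      S : Subset n
      S = subset used?

      same-colour : ∀ {u v x a b} → Mono G c u a → Mono G c v b → Adj G u x → Adj G v x → a ≡ b
      same-colour mono-a mono-b ux vx = trans (sym (mono-a _ ux)) (mono-b _ vx)

      star-injective : ∀ {u v a b} → Mono G c u a → Mono G c v b → star a ≡ star b → a ≡ b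
      star-injective {a = a} {b} mono-a mono-b eq =
        let x , ax = some (star a)
        in same-colour (star-mono a mono-a) (star-mono b mono-b) ax (subst (λ v → Adj G v x) eq ax)

      independent : Independent (square G) S
      independent u v u∈ v∈ (u≢v , dist)
        with a , mono-a , refl ← ∈-subset⁻ used? u∈
           | b , mono-b , refl ← ∈-subset⁻ used? v∈
           | within-two G dist
      ... | inj₁ u≡v = u≢v u≡v
      ... | inj₂ (inj₁ adj) = star-apart a b mono-a mono-b adj
      ... | inj₂ (inj₂ (x , ux , vx)) = u≢v (cong star (same-colour mono-a mono-b ux vx))

    spread : Goal
    spread = S , independent , Refine.refined G reg c base r r≢0 r-free S star
      (λ {v} {a} mono → ∈-subset⁺ used? (a , star-mono a mono , refl)) star-injective

  module _ (c : Fin n → Fin L) (base : Base G c) where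

    private
      module Given = Base base

    W⇒≢0 : ∀ {v} → Mono G c v 0F → c v ≢ 0F
    W⇒≢0 {v} Wv = Given.mono-0 Wv (proj₂ (some v))

    -- The vertices of W have no neighbour outside the class of colour 0, so their
    -- colours can be replaced by arbitrary non-zero colours.
    module Repaint (d : Fin n → Fin L) (d≢0 : ∀ v → d v ≢ 0F) where

      painted : Fin n → Fin L
      painted v with mono? G c v 0F
      ... | yes _ = d v
      ... | no  _ = c v

      painted-W : ∀ {v} → Mono G c v 0F → painted v ≡ d v
      painted-W {v} Wv with mono? G c v 0F
      ... | yes _  = refl
      ... | no ¬Wv = contradiction Wv ¬Wv

      painted-¬W : ∀ {v} → ¬ Mono G c v 0F → painted v ≡ c v
      painted-¬W {v} ¬Wv with mono? G c v 0F
      ... | yes Wv = contradiction Wv ¬Wv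
      ... | no _   = refl

      zero⁺ : ∀ {v} → c v ≡ 0F → painted v ≡ 0F
      zero⁺ cv≡0 = trans (painted-¬W λ Wv → W⇒≢0 Wv cv≡0) cv≡0

      zero⁻ : ∀ {v} → painted v ≡ 0F → c v ≡ 0F
      zero⁻ {v} eq with mono? G c v 0F
      ... | yes _ = contradiction eq (d≢0 v)
      ... | no _  = eq

      W⁺ : ∀ {v} → Mono G c v 0F → Mono G painted v 0F
      W⁺ Wv u vu = zero⁺ (Wv u vu)

      W⁻ : ∀ {v} → Mono G painted v 0F → Mono G c v 0F
      W⁻ Wv u vu = zero⁻ (Wv u vu)

      private
        proper′ : Proper G painted
        proper′ u v uv eq with mono? G c u 0F | mono? G c v 0F
        ... | yes Wu | yes Wv = W⇒≢0 Wv (Wu v uv)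
        ... | yes Wu | no _   = d≢0 u (trans eq (Wu v uv))
        ... | no _   | yes Wv = d≢0 v (trans (sym eq) (Wv u (symmetric G uv)))
        ... | no _   | no _   = Given.proper u v uv eq

      painted-base : Base G painted
      painted-base = record
        { proper     = proper′
        ; dominating = λ ≢0 → let u , vu , cu≡0 = Given.dominating (≢0 ∘ zero⁺) in u , vu , zero⁺ cu≡0
        }

    -- Suppose that W has two elements. Paint W with colour 1. If the vertices
    -- with all neighbours of colour 1 are adjacent to all of W, then repainting
    -- w₁ with colour 2 leaves no such vertex, and w₂ can be chosen for colour 0.
    module Several {w₁ w₂ : Fin n} (Ww₁ : Mono G c w₁ 0F) (Ww₂ : Mono G c w₂ 0F) (w₁≢w₂ : w₁ ≢ w₂) where

      private
        d : Fin n → Fin L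
        d v with v ≟ w₁
        ... | yes _ = 2F
        ... | no  _ = 1F

        d≢0 : ∀ v → d v ≢ 0F
        d≢0 v with v ≟ w₁
        ... | yes _ = λ ()
        ... | no  _ = λ ()

        d≢3 : ∀ v → d v ≢ 3F
        d≢3 v with v ≟ w₁
        ... | yes _ = λ ()
        ... | no  _ = λ ()

        d-w₁ : d w₁ ≡ 2F
        d-w₁ with w₁ ≟ w₁
        ... | yes _ = refl
        ... | no ≢  = contradiction refl ≢

        d-w₂ : d w₂ ≡ 1F
        d-w₂ with w₂ ≟ w₁
        ... | yes eq = contradiction (sym eq) w₁≢w₂
        ... | no _   = refl

        module R₁ = Repaint (λ _ → 1F) (λ _ ())
        module R₂ = Repaint d d≢0
        c₁ = R₁.painted
        c₂ = R₂.painted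

        mono₂⇒mono₁ : ∀ {z} → Mono G c₂ z 1F → Mono G c₁ z 1F
        mono₂⇒mono₁ mono u zu with mono? G c u 0F | mono u zu
        ... | yes _ | _  = refl
        ... | no  _ | eq = eq

      several : Goal
      several with any? (λ z → any? λ w → mono? G c₁ z 1F ×-dec mono? G c w 0F ×-dec ¬? (adj? G w z))
      ... | yes (z , w , mono , Ww , ¬wz) =
        Spread.spread c₁ R₁.painted-base 2F (λ ())
          (λ W₁ eq → 1≢2 (trans (sym (R₁.painted-W (R₁.W⁻ W₁))) eq))
          w (λ _ → R₁.W⁺ Ww)
          (λ _ _ → z , subst (Mono G c₁ z) (sym (R₁.painted-W Ww)) mono , ¬wz)
        where
        1≢2 : _≢_ {A = Fin L} 1F 2F
        1≢2 ()
      ... | no complete =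
        Spread.spread c₂ R₂.painted-base 3F (λ ())
          (λ {w} W₂ eq → d≢3 w (trans (sym (R₂.painted-W (R₂.W⁻ W₂))) eq))
          w₂ (λ _ → R₂.W⁺ Ww₂)
          (λ _ {z} mono → contradiction mono (none z))
        where
        none : ∀ z → ¬ Mono G c₂ z (c₂ w₂)
        none z mono =
          let mono′ = subst (Mono G c₂ z) (trans (R₂.painted-W Ww₂) d-w₂) mono
              w₁z = decidable-stable (adj? G w₁ z) λ ¬w₁z → complete (z , w₁ , mono₂⇒mono₁ mono′ , Ww₁ , ¬w₁z)
          in 2≢1 (trans (sym (trans (R₂.painted-W Ww₁) d-w₁)) (mono′ w₁ (symmetric G w₁z)))
          where
          2≢1 : _≢_ {A = Fin L} 2F 1F
          2≢1 ()

    -- Suppose that w is the only element of W.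
    module Single {w : Fin n} (Ww : Mono G c w 0F) (unique : ∀ {v} → Mono G c v 0F → v ≡ w) where

      private
        module R (d : Fin (3 + m)) = Repaint (λ _ → suc d) (λ _ ())

      -- When w is painted with the non-zero colour suc d, the choice of w for the
      -- colour 0 conflicts with every choice for the colour suc d.
      Stuck : Fin (3 + m) → Set
      Stuck d = (∃[ z ] Mono G (R.painted d) z (suc d)) ×
                (∀ z → Mono G (R.painted d) z (suc d) → Adj G w z)

      stuck? : U.Decidable Stuck
      stuck? d = any? (λ z → mono? G (R.painted d) z (suc d)) ×-dec
                 all? (λ z → mono? G (R.painted d) z (suc d) →-dec adj? G w z)

      -- The colour r only has to differ from 0 and from the colour of w.
      free : ∀ d → ¬ Stuck d → Goal
      free d ¬stuck = Spread.spread (R.painted d) (R.painted-base d) r r≢0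
        (λ W′ eq → r≢d (trans (sym eq) (R.painted-W d (R.W⁻ d W′))))
        w (λ _ → R.W⁺ d Ww) away
        where
        r = proj₁ (avoid-two 0F (suc d))
        r≢0 = proj₁ (proj₂ (avoid-two 0F (suc d)))
        r≢d = proj₂ (proj₂ (avoid-two 0F (suc d)))
        p = R.painted d
        pw≡d : p w ≡ suc d
        pw≡d = R.painted-W d Ww

        away : Mono G p w 0F → ∀ {z} → Mono G p z (p w) → ∃[ z′ ] Mono G p z′ (p w) × ¬ Adj G w z′
        away _ {z} mono with any? (λ z′ → mono? G p z′ (p w) ×-dec ¬? (adj? G w z′))
        ... | yes found = found
        ... | no  none  = contradiction
          ((z , subst (Mono G p z) pw≡d mono) ,
           λ z′ mono′ → decidable-stable (adj? G w z′) λ ¬wz′ →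
             none (z′ , subst (Mono G p z′) (sym pw≡d) mono′ , ¬wz′))
          ¬stuck

      -- If all non-zero colours are stuck, let b be the colouring with w painted
      -- 1. A vertex not adjacent to w then has no monochromatic neighbourhood of
      -- non-zero colour. The vertices z₁ and z₂ are adjacent to w, and their
      -- other neighbours have colour 1 and 2 respectively.
      module AllStuck (stuck : ∀ d → Stuck d) where

        private
          b : Fin n → Fin L
          b = R.painted 0F

          module B₁ = Base (R.painted-base 0F)

          bw≡1 : b w ≡ 1F
          bw≡1 = R.painted-W 0F Ww

          Wb : ∀ {u} → Adj G w u → b u ≡ 0F
          Wb = R.W⁺ 0F Ww _

          W-unique : ∀ {v} → Mono G b v 0F → v ≡ w
          W-unique W′ = unique (R.W⁻ 0F W′)

          -- The colours of the other vertices do not depend on that of w.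
          same : ∀ d {u} → u ≢ w → R.painted d u ≡ b u
          same d u≢w = trans (R.painted-¬W d (u≢w ∘ unique)) (sym (R.painted-¬W 0F (u≢w ∘ unique)))

          ≢centre : ∀ {z u} → ¬ Adj G w z → Adj G z u → u ≢ w
          ≢centre ¬wz zu refl = ¬wz (symmetric G zu)

          stuck-b : ∀ {z} d → d ≢ 0F → ¬ Adj G w z → ¬ Mono G b z d
          stuck-b     0F      0≢0 ¬wz mono = 0≢0 refl
          stuck-b {z} (suc d) _   ¬wz mono = ¬wz (proj₂ (stuck d) z λ u zu →
            trans (same d (≢centre ¬wz zu)) (mono u zu))

          z₁ z₂ : Fin n
          z₁ = proj₁ (proj₁ (stuck 0F))
          z₂ = proj₁ (proj₁ (stuck 1F))

          mono-z₁ : Mono G b z₁ 1F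
          mono-z₁ = proj₂ (proj₁ (stuck 0F))

          w~z₁ : Adj G w z₁
          w~z₁ = proj₂ (stuck 0F) z₁ mono-z₁

          w~z₂ : Adj G w z₂
          w~z₂ = proj₂ (stuck 1F) z₂ (proj₂ (proj₁ (stuck 1F)))

          near-z₂ : ∀ {u} → Adj G z₂ u → u ≢ w → b u ≡ 2F
          near-z₂ zu u≢w = trans (sym (same 1F u≢w)) (proj₂ (proj₁ (stuck 1F)) _ zu)

          z₁≢z₂ : z₁ ≢ z₂
          z₁≢z₂ eq with q , zq , q≢w ← another G (2≤deg z₂) w
            with () ← trans (sym (mono-z₁ q (subst (λ z → Adj G z q) (sym eq) zq))) (near-z₂ zq q≢w)

          -- A vertex whose neighbourhood would become monochromatic if z₂ got the
          -- colour 3.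
          Obstacle : Fin n → Set
          Obstacle y = Adj G z₂ y × (∀ u → Adj G y u → u ≢ z₂ → b u ≡ 3F)

          obstacle? : U.Decidable Obstacle
          obstacle? y = adj? G z₂ y ×-dec all? λ u → adj? G y u →-dec (¬? (u ≟ z₂) →-dec (b u ≟ 3F))

        -- If y is an obstacle, then z₁ and y are at distance at least three. Only
        -- the colours 0 and 1 need spare colours, which are named z₁ and y.
        module _ {y : Fin n} (z₂y : Adj G z₂ y) (around : ∀ u → Adj G y u → u ≢ z₂ → b u ≡ 3F) where

          private
            star : Fin L → Fin n
            star 0F      = z₁
            star (suc _) = y

            S? : U.Decidable (λ v → v ≡ z₁ ⊎ v ≡ y)
            S? v = (v ≟ z₁) ⊎-dec (v ≟ y)

            S : Subset n
            S = subset S?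

            star∈ : ∀ a → star a ∈ S
            star∈ 0F      = ∈-subset⁺ S? (inj₁ refl)
            star∈ (suc _) = ∈-subset⁺ S? (inj₂ refl)

            z₁≢y : z₁ ≢ y
            z₁≢y eq = B₁.proper z₂ y z₂y (trans (Wb w~z₂) (trans (sym (Wb w~z₁)) (cong b eq)))

            -- Only 0 and 1 are colours of monochromatic neighbourhoods.
            mono-colours : ∀ {v a} → Mono G b v (suc (suc a)) → Empty
            mono-colours {v} mono with adj? G w v
            ... | no ¬wv = stuck-b _ (λ ()) ¬wv mono
            ... | yes wv with () ← trans (sym bw≡1) (mono w (symmetric G wv))

            star-injective : ∀ {u v} a b′ → Mono G b u a → Mono G b v b′ → star a ≡ star b′ → a ≡ b′
            star-injective 0F 0F _ _ _ = refl
            star-injective 1F 1F _ _ _ = refl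
            star-injective 0F (suc _) _ _ eq = contradiction eq z₁≢y
            star-injective (suc _) 0F _ _ eq = contradiction (sym eq) z₁≢y
            star-injective (suc (suc _)) (suc _) mono _ _ = contradiction mono mono-colours
            star-injective 1F (suc (suc _)) _ mono _ = contradiction mono mono-colours

            far : ¬ Adj G z₁ y × (∀ x → Adj G z₁ x → ¬ Adj G y x)
            far = nonadj , nocommon
              where
              nonadj : ¬ Adj G z₁ y
              nonadj z₁y with () ← trans (sym (Wb w~z₁)) (around z₁ (symmetric G z₁y) z₁≢z₂)
              nocommon : ∀ x → Adj G z₁ x → ¬ Adj G y x
              nocommon x z₁x yx with x ≟ z₂
              ... | yes refl with () ← trans (sym (mono-z₁ x z₁x)) (Wb w~z₂)
              nocommon x z₁x yx | no x≢z₂ with () ← trans (sym (mono-z₁ x z₁x)) (around x yx x≢z₂)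

            independent : Independent (square G) S
            independent u v u∈ v∈ (u≢v , dist) with ∈-subset⁻ S? u∈ | ∈-subset⁻ S? v∈ | within-two G dist
            ... | _ | _ | inj₁ u≡v = u≢v u≡v
            ... | inj₁ refl | inj₁ refl | _ = u≢v refl
            ... | inj₂ refl | inj₂ refl | _ = u≢v refl
            ... | inj₁ refl | inj₂ refl | inj₂ (inj₁ uv) = proj₁ far uv
            ... | inj₁ refl | inj₂ refl | inj₂ (inj₂ (x , ux , vx)) = proj₂ far x ux vx
            ... | inj₂ refl | inj₁ refl | inj₂ (inj₁ uv) = proj₁ far (symmetric G uv)
            ... | inj₂ refl | inj₁ refl | inj₂ (inj₂ (x , ux , vx)) = proj₂ far x vx ux

          two-spare : Goal
          two-spare = S , independent ,
            Refine.refined G reg b (R.painted-base 0F) 2F (λ ())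
              (λ { W′ eq → 1≢2 (trans (sym bw≡1) (trans (cong b (sym (W-unique W′))) eq)) })
              S star (λ {_} {a} _ → star∈ a) (λ {_} {_} {a} {a′} → star-injective a a′)
            where
            1≢2 : _≢_ {A = Fin L} 1F 2F
            1≢2 ()

        -- If there is no obstacle, then one spare colour suffices: w gets the colour
        -- 0, z₂ gets the colour 3, and the other neighbours of w get the spare
        -- colour named w.
        module _ (no-obstacle : ∀ y → ¬ Obstacle y) where

          private
            data Role (v : Fin n) : Set where
              isCentre : v ≡ w → Role v
              isMoved  : v ≡ z₂ → Role v
              isNear   : v ≢ z₂ → Adj G w v → Role v
              isOther  : v ≢ w → v ≢ z₂ → ¬ Adj G w v → Role v

            role : ∀ v → Role v
            role v with v ≟ w | v ≟ z₂ | adj? G w v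
            ... | yes v≡w | _        | _      = isCentre v≡w
            ... | no _    | yes v≡z₂ | _      = isMoved v≡z₂
            ... | no _    | no v≢z₂  | yes wv = isNear v≢z₂ wv
            ... | no v≢w  | no v≢z₂  | no ¬wv = isOther v≢w v≢z₂ ¬wv

            paint : ∀ {v} → Role v → Fin L ⊎ Fin n
            paint     (isCentre _)    = inj₁ 0F
            paint     (isMoved _)     = inj₁ 3F
            paint     (isNear _ _)    = inj₂ w
            paint {v} (isOther _ _ _) = inj₁ (b v)

            colour : Fin n → Fin L ⊎ Fin n
            colour v = paint (role v)

            named : ∀ {v t} (ρ : Role v) → paint ρ ≡ inj₂ t → t ∈ ⁅ w ⁆
            named (isNear _ _) refl = x∈⁅x⁆ w

            z₂-edge : ∀ {v} → Adj G z₂ v → v ≢ w → b v ≢ 3F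
            z₂-edge z₂v v≢w eq with () ← trans (sym (near-z₂ z₂v v≢w)) eq

            w-edge : ∀ {u v} → Adj G w u → Adj G w v → ¬ Adj G u v
            w-edge wu wv uv = B₁.proper _ _ uv (trans (Wb wu) (sym (Wb wv)))

            role-proper : ∀ {u v} → Adj G u v → (ρ : Role u) (ρ′ : Role v) → paint ρ ≢ paint ρ′
            role-proper uv (isCentre refl) (isCentre refl) _ = loopless G refl uv
            role-proper uv (isCentre refl) (isOther _ _ ¬wv) _ = ¬wv uv
            role-proper uv (isOther _ _ ¬wu) (isCentre refl) _ = ¬wu (symmetric G uv)
            role-proper uv (isMoved refl) (isMoved refl) _ = loopless G refl uv
            role-proper uv (isMoved refl) (isOther v≢w _ _) eq = z₂-edge uv v≢w (sym (inj₁-injective eq))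
            role-proper uv (isOther u≢w _ _) (isMoved refl) eq = z₂-edge (symmetric G uv) u≢w (inj₁-injective eq)
            role-proper uv (isNear _ wu) (isNear _ wv) _ = w-edge wu wv uv
            role-proper uv (isOther _ _ _) (isOther _ _ _) eq = B₁.proper _ _ uv (inj₁-injective eq)

            -- Vertices of non-zero colour other than w keep their colours.
            kept : ∀ {v} → v ≢ w → b v ≢ 0F → (ρ : Role v) → paint ρ ≡ inj₁ (b v)
            kept v≢w bv≢0 (isCentre v≡w)  = contradiction v≡w v≢w
            kept v≢w bv≢0 (isMoved refl)  = contradiction (Wb w~z₂) bv≢0
            kept v≢w bv≢0 (isNear _ wv)   = contradiction (Wb wv) bv≢0
            kept v≢w bv≢0 (isOther _ _ _) = refl

            centre : (ρ : Role w) → paint ρ ≡ inj₁ 0F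
            centre (isCentre _) = refl
            centre (isMoved w≡z₂) = contradiction w~z₂ (loopless G w≡z₂)
            centre (isNear _ ww) = contradiction ww (loopless G refl)
            centre (isOther w≢w _ _) = contradiction refl w≢w

            moved : (ρ : Role z₂) → paint ρ ≡ inj₁ 3F
            moved (isCentre z₂≡w) = contradiction w~z₂ (loopless G (sym z₂≡w))
            moved (isMoved _) = refl
            moved (isNear z₂≢z₂ _) = contradiction refl z₂≢z₂
            moved (isOther _ z₂≢z₂ _) = contradiction refl z₂≢z₂

            two-w : TwoColoured G colour w
            two-w =
              let q , wq , q≢z₂ = another G (2≤deg w) z₂
              in z₂ , q , w~z₂ , wq , λ eq → clash wq q≢z₂ (role q) (trans (sym (moved (role z₂))) eq)
              where
              clash : ∀ {q} → Adj G w q → q ≢ z₂ → (ρ : Role q) → inj₁ 3F ≢ paint ρ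
              clash wq q≢z₂ (isCentre refl) _ = loopless G refl wq
              clash wq q≢z₂ (isMoved q≡z₂) _ = q≢z₂ q≡z₂
              clash wq q≢z₂ (isOther _ _ ¬wq) _ = ¬wq wq

            two-near : ∀ {v} → Adj G w v → TwoColoured G colour v
            two-near {v} wv =
              let q , vq , q≢w = another G (2≤deg v) w
                  bq≢0 = λ bq≡0 → B₁.proper v q vq (trans (Wb wv) (sym bq≡0))
              in w , q , symmetric G wv , vq , λ eq → bq≢0 (sym (inj₁-injective
                   (trans (sym (centre (role w))) (trans eq (kept q≢w bq≢0 (role q))))))

            two-zero : ∀ {v} → ¬ Adj G w v → b v ≡ 0F → TwoColoured G colour v
            two-zero {v} ¬wv bv≡0 =
              let u , vu = some v
                  u′ , vu′ , bu′≢bu = ¬mono⇒ G (stuck-b _ (nonzero vu) ¬wv)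
              in u , u′ , vu , vu′ , λ eq → bu′≢bu (sym (inj₁-injective (trans (sym (plain vu)) (trans eq (plain vu′)))))
              where
              nonzero : ∀ {u} → Adj G v u → b u ≢ 0F
              nonzero vu bu≡0 = B₁.proper v _ vu (trans bv≡0 (sym bu≡0))
              plain : ∀ {u} → Adj G v u → colour u ≡ inj₁ (b u)
              plain {u} vu = kept (≢centre ¬wv vu) (nonzero vu) (role u)

            -- If v is adjacent to z₂, then v sees 3 at z₂ and another colour elsewhere,
            -- as v is not an obstacle. Otherwise v has a neighbour whose old colour
            -- is 0, now 0 or the spare colour, and one of non-zero old colour.
            two-rest : ∀ {v} → v ≢ w → ¬ Adj G w v → b v ≢ 0F → TwoColoured G colour v
            two-rest {v} v≢w ¬wv bv≢0 with adj? G z₂ v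
            ... | yes z₂v with any? (λ u → adj? G v u ×-dec ¬? (u ≟ z₂) ×-dec ¬? (b u ≟ 3F))
            ...   | yes (u , vu , u≢z₂ , bu≢3) = z₂ , u , symmetric G z₂v , vu , λ eq →
                      not-3 vu u≢z₂ bu≢3 (role u) (trans (sym eq) (moved (role z₂)))
              where
              not-3 : ∀ {u} → Adj G v u → u ≢ z₂ → b u ≢ 3F → (ρ : Role u) → paint ρ ≢ inj₁ 3F
              not-3 vu u≢z₂ bu≢3 (isMoved u≡z₂) _ = u≢z₂ u≡z₂
              not-3 vu u≢z₂ bu≢3 (isOther _ _ _) eq = bu≢3 (inj₁-injective eq)
            ...   | no none = contradiction (z₂v , λ u vu u≢z₂ →
                      decidable-stable (b u ≟ 3F) λ bu≢3 → none (u , vu , u≢z₂ , bu≢3)) (no-obstacle v)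
            two-rest {v} v≢w ¬wv bv≢0 | no ¬z₂v =
              let u , vu , bu≡0 = B₁.dominating bv≢0
                  h , vh , bh≢0 = ¬mono⇒ G (v≢w ∘ W-unique)
              in u , h , vu , vh , λ eq →
                   clash vu bu≡0 bh≢0 (role u) (trans eq (kept (≢centre ¬wv vh) bh≢0 (role h)))
              where
              clash : ∀ {u h} → Adj G v u → b u ≡ 0F → b h ≢ 0F → (ρ : Role u) → paint ρ ≢ inj₁ (b h)
              clash vu bu≡0 bh≢0 (isCentre _) eq = bh≢0 (sym (inj₁-injective eq))
              clash vu bu≡0 bh≢0 (isMoved refl) _ = ¬z₂v (symmetric G vu)
              clash vu bu≡0 bh≢0 (isOther _ _ _) eq = bh≢0 (trans (sym (inj₁-injective eq)) bu≡0)

            two-coloured : ∀ v → TwoColoured G colour v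
            two-coloured v with v ≟ w | adj? G w v | b v ≟ 0F
            ... | yes refl | _      | _        = two-w
            ... | no _     | yes wv | _        = two-near wv
            ... | no _     | no ¬wv | yes bv≡0 = two-zero ¬wv bv≡0
            ... | no v≢w   | no ¬wv | no bv≢0  = two-rest v≢w ¬wv bv≢0

          one-spare : Goal
          one-spare = ⁅ w ⁆ ,
            (λ { u v u∈ v∈ (u≢v , _) → u≢v (trans (x∈⁅y⁆⇒x≡y w u∈) (sym (x∈⁅y⁆⇒x≡y w v∈))) }) ,
            dynamicallyColourable G ⁅ w ⁆ colour (λ {v} → named (role v))
              (λ u v uv → role-proper uv (role u) (role v)) (λ v _ → two-coloured v)

        resolve : Goal
        resolve with any? obstacle?
        ... | yes (y , z₂y , around) = two-spare z₂y around
        ... | no  none               = one-spare λ y obstacle → none (y , obstacle)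

      single : Goal
      single with any? (λ d → ¬? (stuck? d))
      ... | yes (d , ¬stuck) = free d ¬stuck
      ... | no  none         = AllStuck.resolve λ d → decidable-stable (stuck? d) λ ¬stuck → none (d , ¬stuck)

  spare-colours : Colourable G L → Goal
  spare-colours col with base-colouring G col
  ... | c , base with any? (λ w → mono? G c w 0F)
  ...   | yes (w , Ww) with any? (λ v → mono? G c v 0F ×-dec ¬? (v ≟ w))
  ...     | yes (v , Wv , v≢w) = Several.several c base Wv Ww v≢w
  ...     | no  none           = Single.single c base Ww λ {v} Wv → decidable-stable (v ≟ w) λ v≢w → none (v , Wv , v≢w)
  spare-colours col | c , base | no none with any? {n} (λ _ → yes tt)
  -- If W is empty, the arbitrary vertex v is not named.
  ...     | yes (v , _) = Spread.spread c base 1F (λ ()) (λ Wv _ → none (_ , Wv)) v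
              (λ Wv → contradiction (_ , Wv) none) (λ Wv → contradiction (_ , Wv) none)
  ...     | no  no-vertex = ⊥ , (λ _ _ u∈⊥ → contradiction u∈⊥ ∉⊥) ,
              dynamicallyColourable G ⊥ (inj₁ ∘ c) (λ ())
                (λ u → contradiction (u , tt) no-vertex) (λ v → contradiction (v , tt) no-vertex)

------------------------------------------------------------------------
-- The bounds

low-degree : ∀ {n} (G : Graph n) → (∀ v → degree G v ≤ 1) → ∀ {t} → χ₂ G ≤ χ G + t
low-degree G ≤1 = let c , proper = χ-colouring G in
  ℕ.≤-trans (χ₂≤ G (c , proper , λ v 2≤ → contradiction (ℕ.≤-trans 2≤ (≤1 v)) λ { (s≤s ()) })) (ℕ.m≤m+n _ _)

regular-χ₂≤χ+α² : ∀ {n} (G : Graph n) k → Regular G k → 4 ≤ χ G → χ₂ G ≤ χ G + α (square G)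
regular-χ₂≤χ+α² G (suc (suc k)) reg 4≤ with χ G | χ-colouring G | 4≤
... | suc (suc (suc (suc m))) | col | s≤s (s≤s (s≤s (s≤s z≤n))) =
  let S , ind , dyn = Choose.spare-colours G reg col
  in ℕ.≤-trans (χ₂≤ G dyn) (ℕ.+-monoʳ-≤ (4 + m) (∣∣≤α (square G) ind))
regular-χ₂≤χ+α² G zero reg _ = low-degree G λ v → subst (_≤ 1) (sym (reg v)) z≤n
regular-χ₂≤χ+α² G (suc zero) reg _ = low-degree G λ v → subst (_≤ 1) (sym (reg v)) ℕ.≤-refl

theorem2 :
    (∀ {n} (G : Graph n) → 4 ≤ χ G → χ₂ G ≤ χ G + α G) ×
    (∀ {n} (G : Graph n) (k : ℕ) → Regular G k → 4 ≤ χ G → χ₂ G ≤ χ G + α (square G))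
theorem2 = (λ G 4≤ → χ₂≤χ+α G (ℕ.≤-trans (ℕ.n≤1+n 3) 4≤)) , regular-χ₂≤χ+α²
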